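{- There is an absolute constant $C>0$ such that for all $k\ge 1$ and $n\ge 2$ and every metric space with $n$ points, there is a $(C\cdot 2^k\log n)$-competitive randomized online algorithm (against oblivious adversaries) for the hard $k$-taxi problem on that metric space. That is, there is an $O(2^k\log n)$-competitive randomized algorithm for the hard $k$-taxi problem on metric spaces of $n$ points.
   Context: **Hard $k$-taxi problem.** Let $(M,d)$ be a metric space. A configuration is a multiset of $k$ points of $M$ (the taxi positions). Given an initial configuration and a sequence of requests $\sigma=(r_1,\dots,r_m)$ with $r_i=(s_i,t_i)\in M^2$, an algorithm must move the taxis so as to serve the requests in order; a taxi serves $r_i$ by first moving to $s_i$ and then to $t_i$. The cost is the total distance travelled by all taxis, except that the movement of the serving taxi from $s_i$ to $t_i$ is not counted. An online algorithm must serve each request without knowledge of future requests. **Competitiveness.** A randomized online algorithm $A$ is $\rho$-competitive (against oblivious adversaries) if $E(\mathrm{cost}_A(\sigma))\le \rho\,\mathrm{OPT}(\sigma)+c$ for every request sequence $\sigma$ (fixed in advance, independently of the random choices of $A$), where $\mathrm{OPT}(\sigma)$ is the optimal offline cost of serving $\sigma$ from the same initial configuration and $c$ is a constant independent of $\sigma$. -}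

module Defs where

open import Data.Fin using (Fin; fromℕ<)
open import Data.Integer using (+_; +[1+_])
import Data.Integer as ℤ
import Data.Integer.Properties as ℤₚ
open import Data.List using (List; []; _∷_; map; foldr; length; allFin; cartesianProductWith)
open import Data.List.Relation.Unary.All using (All)
open import Data.Nat using (ℕ; suc; NonZero)
import Data.Nat as ℕ
import Data.Nat.Properties as ℕₚ
open import Data.Nat.Induction using (<-rec)
open import Data.Nat.Logarithm using (⌊log₂_⌋; ⌊log₂⌋-mono-≤; ⌊log₂[2^n]⌋≡n; ⌊log₂⌊n/2⌋⌋≡⌊log₂n⌋∸1)
open import Data.Product using (_×_; _,_; proj₁; proj₂; ∃; ∃-syntax)
open import Data.Rational using (ℚ; mkℚ; 0ℚ; 1ℚ; ½)
import Data.Rational as ℚ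
import Data.Rational.Properties as ℚₚ
open import Data.Rational.Solver using (module +-*-Solver)
open import Data.Rational.Unnormalised using (mkℚᵘ)
import Data.Rational.Unnormalised as ℚᵘ
import Data.Rational.Unnormalised.Properties as ℚᵘₚ
open import Data.Sum using (inj₁; inj₂)
open import Data.Vec using (Vec; []; _∷_; lookup; zipWith; toList; replicate; _[_]≔_)
open import Function.Metric.Definitions using (Definite; Symmetric; TriangleInequality)
open import Relation.Binary.PropositionalEquality using (_≡_; _≢_; refl; sym; trans; cong; cong₂; subst; subst₂; module ≡-Reasoning)
open import Relation.Nullary using (yes; no; contradiction)

∣p-q∣≤e : ∀ {p q e} → p ℚ.≤ q ℚ.+ e → q ℚ.≤ p ℚ.+ e → ℚ.∣ p ℚ.- q ∣ ℚ.≤ e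
∣p-q∣≤e {p} {q} {e} p≤ q≤ with ℚₚ.∣p∣≡p∨∣p∣≡-p (p ℚ.- q)
... | inj₁ eq = begin
  ℚ.∣ p ℚ.- q ∣      ≡⟨ eq ⟩
  p ℚ.- q            ≤⟨ ℚₚ.+-monoˡ-≤ (ℚ.- q) p≤ ⟩
  q ℚ.+ e ℚ.- q      ≡⟨ solve 2 (λ q e → q :+ e :- q := e) refl q e ⟩
  e                  ∎
  where open ℚₚ.≤-Reasoning; open +-*-Solver
... | inj₂ eq = begin
  ℚ.∣ p ℚ.- q ∣      ≡⟨ eq ⟩
  ℚ.- (p ℚ.- q)      ≡⟨ solve 2 (λ p q → :- (p :- q) := q :- p) refl p q ⟩
  q ℚ.- p            ≤⟨ ℚₚ.+-monoˡ-≤ (ℚ.- p) q≤ ⟩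
  p ℚ.+ e ℚ.- p      ≡⟨ solve 2 (λ p e → p :+ e :- p := e) refl p e ⟩
  e                  ∎
  where open ℚₚ.≤-Reasoning; open +-*-Solver

p≤∣p∣ : ∀ p → p ℚ.≤ ℚ.∣ p ∣
p≤∣p∣ p with ℚₚ.≤-total 0ℚ p
... | inj₁ 0≤p = ℚₚ.≤-reflexive (sym (ℚₚ.0≤p⇒∣p∣≡p 0≤p))
... | inj₂ p≤0 = ℚₚ.≤-trans p≤0 (ℚₚ.0≤∣p∣ p)

∣p-q∣≤e⇒p≤q+e : ∀ {p q e} → ℚ.∣ p ℚ.- q ∣ ℚ.≤ e → p ℚ.≤ q ℚ.+ e
∣p-q∣≤e⇒p≤q+e {p} {q} {e} h = begin
  p                       ≡⟨ solve 2 (λ p q → p := q :+ (p :- q)) refl p q ⟩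
  q ℚ.+ (p ℚ.- q)         ≤⟨ ℚₚ.+-monoʳ-≤ q (ℚₚ.≤-trans (p≤∣p∣ (p ℚ.- q)) h) ⟩
  q ℚ.+ e                 ∎
  where open ℚₚ.≤-Reasoning; open +-*-Solver

0<½*p : ∀ {p} → 0ℚ ℚ.< p → 0ℚ ℚ.< ½ ℚ.* p
0<½*p {p} 0<p = subst (ℚ._< ½ ℚ.* p) (ℚₚ.*-zeroʳ ½) (ℚₚ.*-monoʳ-<-pos ½ {0ℚ} {p} 0<p)

⊓-bound : ∀ {p q r s e} → p ℚ.≤ r ℚ.+ e → q ℚ.≤ s ℚ.+ e → p ℚ.⊓ q ℚ.≤ r ℚ.⊓ s ℚ.+ e
⊓-bound {p} {q} {r} {s} {e} p≤ q≤ with ℚₚ.⊓-sel r s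
... | inj₁ eq = subst (λ t → p ℚ.⊓ q ℚ.≤ t ℚ.+ e) (sym eq) (ℚₚ.≤-trans (ℚₚ.p⊓q≤p p q) p≤)
... | inj₂ eq = subst (λ t → p ℚ.⊓ q ℚ.≤ t ℚ.+ e) (sym eq) (ℚₚ.≤-trans (ℚₚ.p⊓q≤q p q) q≤)

1/[1+N]≤ε : ∀ ε → 0ℚ ℚ.< ε → ∃[ N ] (∀ n → N ℕ.≤ n → (+ 1) ℚ./ suc n ℚ.≤ ε)
1/[1+N]≤ε (mkℚ +[1+ a ] d c) _ = d , λ n d≤n → ℚₚ.toℚᵘ-cancel-≤
  (ℚᵘₚ.≤-trans (ℚᵘₚ.≤-reflexive (ℚₚ.toℚᵘ-fromℚᵘ (mkℚᵘ (+ 1) n)))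
    (ℚᵘ.*≤* (ℤ.+≤+ (ℕₚ.≤-trans (ℕₚ.≤-reflexive (ℕₚ.*-identityˡ (suc d)))
      (ℕₚ.≤-trans (ℕ.s≤s d≤n) (ℕₚ.m≤m+n (suc n) (a ℕ.* suc n)))))))
1/[1+N]≤ε (mkℚ (+ 0) d c) (ℚ.*<* (ℤ.+<+ ()))
1/[1+N]≤ε (mkℚ ℤ.-[1+ a ] d c) (ℚ.*<* ())

IsCauchy : (ℕ → ℚ) → Set
IsCauchy x = ∀ ε → 0ℚ ℚ.< ε →
  ∃[ N ] (∀ m n → N ℕ.≤ m → N ℕ.≤ n → ℚ.∣ x m ℚ.- x n ∣ ℚ.≤ ε)

record ℝ : Set where
  constructor mkℝ
  field
    seq    : ℕ → ℚ
    cauchy : IsCauchy seq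

open ℝ public

infix  4 _≈_ _≤_ _<_
infixl 6 _+_
infixl 7 _*_ _⊓_

_≈_ : ℝ → ℝ → Set
x ≈ y = ∀ ε → 0ℚ ℚ.< ε → ∃[ N ] (∀ n → N ℕ.≤ n → ℚ.∣ seq x n ℚ.- seq y n ∣ ℚ.≤ ε)

_≤_ : ℝ → ℝ → Set
x ≤ y = ∀ ε → 0ℚ ℚ.< ε → ∃[ N ] (∀ n → N ℕ.≤ n → seq x n ℚ.≤ seq y n ℚ.+ ε)

_<_ : ℝ → ℝ → Set
x < y = ∃[ ε ] (0ℚ ℚ.< ε × ∃[ N ] (∀ n → N ℕ.≤ n → seq x n ℚ.+ ε ℚ.≤ seq y n))

fromℚ : ℚ → ℝ
fromℚ q = mkℝ (λ _ → q) λ ε 0<ε → 0 , λ _ _ _ _ →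
  subst (ℚ._≤ ε) (sym (cong ℚ.∣_∣ (ℚₚ.+-inverseʳ q))) (ℚₚ.<⇒≤ 0<ε)

fromℕ : ℕ → ℝ
fromℕ n = fromℚ ((+ n) ℚ./ 1)

0ℝ 1ℝ : ℝ
0ℝ = fromℕ 0
1ℝ = fromℕ 1

_+_ : ℝ → ℝ → ℝ
mkℝ x cx + mkℝ y cy = mkℝ (λ n → x n ℚ.+ y n) λ ε 0<ε →
  let N₁ , h₁ = cx (½ ℚ.* ε) (0<½*p 0<ε)
      N₂ , h₂ = cy (½ ℚ.* ε) (0<½*p 0<ε)
  in N₁ ℕ.⊔ N₂ , λ m n N≤m N≤n → begin
    ℚ.∣ (x m ℚ.+ y m) ℚ.- (x n ℚ.+ y n) ∣
      ≡⟨ cong ℚ.∣_∣ (solve 4 (λ a b c d → (a :+ b) :- (c :+ d) := (a :- c) :+ (b :- d))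
           refl (x m) (y m) (x n) (y n)) ⟩
    ℚ.∣ (x m ℚ.- x n) ℚ.+ (y m ℚ.- y n) ∣
      ≤⟨ ℚₚ.∣p+q∣≤∣p∣+∣q∣ (x m ℚ.- x n) (y m ℚ.- y n) ⟩
    ℚ.∣ x m ℚ.- x n ∣ ℚ.+ ℚ.∣ y m ℚ.- y n ∣
      ≤⟨ ℚₚ.+-mono-≤ (h₁ m n (ℕₚ.m⊔n≤o⇒m≤o N₁ N₂ N≤m) (ℕₚ.m⊔n≤o⇒m≤o N₁ N₂ N≤n))
                     (h₂ m n (ℕₚ.m⊔n≤o⇒n≤o N₁ N₂ N≤m) (ℕₚ.m⊔n≤o⇒n≤o N₁ N₂ N≤n)) ⟩
    ½ ℚ.* ε ℚ.+ ½ ℚ.* ε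
      ≡⟨ solve 1 (λ e → con ½ :* e :+ con ½ :* e := e) refl ε ⟩
    ε ∎
  where open ℚₚ.≤-Reasoning; open +-*-Solver

_⊓_ : ℝ → ℝ → ℝ
mkℝ x cx ⊓ mkℝ y cy = mkℝ (λ n → x n ℚ.⊓ y n) λ ε 0<ε →
  let N₁ , h₁ = cx ε 0<ε
      N₂ , h₂ = cy ε 0<ε
      one-sided : ∀ m n → N₁ ℕ.⊔ N₂ ℕ.≤ m → N₁ ℕ.⊔ N₂ ℕ.≤ n →
                  x m ℚ.⊓ y m ℚ.≤ x n ℚ.⊓ y n ℚ.+ ε
      one-sided m n N≤m N≤n = ⊓-bound {x m} {y m} {x n} {y n} {ε}
        (∣p-q∣≤e⇒p≤q+e (h₁ m n (ℕₚ.m⊔n≤o⇒m≤o N₁ N₂ N≤m) (ℕₚ.m⊔n≤o⇒m≤o N₁ N₂ N≤n)))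
        (∣p-q∣≤e⇒p≤q+e (h₂ m n (ℕₚ.m⊔n≤o⇒n≤o N₁ N₂ N≤m) (ℕₚ.m⊔n≤o⇒n≤o N₁ N₂ N≤n)))
  in N₁ ℕ.⊔ N₂ , λ m n N≤m N≤n → ∣p-q∣≤e (one-sided m n N≤m N≤n) (one-sided n m N≤n N≤m)

eventually-bounded : ∀ {x} → IsCauchy x →
  ∃[ B ] (0ℚ ℚ.< B × ∃[ N ] (∀ n → N ℕ.≤ n → ℚ.∣ x n ∣ ℚ.≤ B))
eventually-bounded {x} cx =
  let N , h = cx 1ℚ (ℚₚ.positive⁻¹ 1ℚ)
  in ℚ.∣ x N ∣ ℚ.+ 1ℚ
   , ℚₚ.+-mono-≤-< (ℚₚ.0≤∣p∣ (x N)) (ℚₚ.positive⁻¹ 1ℚ)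
   , N , λ n N≤n → begin
       ℚ.∣ x n ∣
         ≡⟨ cong ℚ.∣_∣ (solve 2 (λ a b → a := b :+ (a :- b)) refl (x n) (x N)) ⟩
       ℚ.∣ x N ℚ.+ (x n ℚ.- x N) ∣
         ≤⟨ ℚₚ.∣p+q∣≤∣p∣+∣q∣ (x N) (x n ℚ.- x N) ⟩
       ℚ.∣ x N ∣ ℚ.+ ℚ.∣ x n ℚ.- x N ∣
         ≤⟨ ℚₚ.+-monoʳ-≤ ℚ.∣ x N ∣ (h n N N≤n ℕₚ.≤-refl) ⟩
       ℚ.∣ x N ∣ ℚ.+ 1ℚ ∎
  where open ℚₚ.≤-Reasoning; open +-*-Solver

*-mono-nonNeg : ∀ {a b c d} → 0ℚ ℚ.≤ b → 0ℚ ℚ.≤ c → a ℚ.≤ c → b ℚ.≤ d → a ℚ.* b ℚ.≤ c ℚ.* d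
*-mono-nonNeg {a} {b} {c} {d} 0≤b 0≤c a≤c b≤d = ℚₚ.≤-trans
  (ℚₚ.*-monoʳ-≤-nonNeg b {{ℚ.nonNegative 0≤b}} a≤c)
  (ℚₚ.*-monoˡ-≤-nonNeg c {{ℚ.nonNegative 0≤c}} b≤d)

∣pq-rs∣-bound : ∀ {p q r s A B δ} → 0ℚ ℚ.≤ A → 0ℚ ℚ.≤ B → ℚ.∣ p ∣ ℚ.≤ A → ℚ.∣ s ∣ ℚ.≤ B →
  ℚ.∣ p ℚ.- r ∣ ℚ.≤ δ → ℚ.∣ q ℚ.- s ∣ ℚ.≤ δ → ℚ.∣ p ℚ.* q ℚ.- r ℚ.* s ∣ ℚ.≤ A ℚ.* δ ℚ.+ B ℚ.* δ
∣pq-rs∣-bound {p} {q} {r} {s} {A} {B} {δ} 0≤A 0≤B p≤A s≤B p-r≤δ q-s≤δ = begin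
    ℚ.∣ p ℚ.* q ℚ.- r ℚ.* s ∣
      ≡⟨ cong ℚ.∣_∣ (solve 4 (λ p q r s → p :* q :- r :* s := p :* (q :- s) :+ s :* (p :- r))
           refl p q r s) ⟩
    ℚ.∣ p ℚ.* (q ℚ.- s) ℚ.+ s ℚ.* (p ℚ.- r) ∣
      ≤⟨ ℚₚ.∣p+q∣≤∣p∣+∣q∣ (p ℚ.* (q ℚ.- s)) (s ℚ.* (p ℚ.- r)) ⟩
    ℚ.∣ p ℚ.* (q ℚ.- s) ∣ ℚ.+ ℚ.∣ s ℚ.* (p ℚ.- r) ∣
      ≡⟨ cong₂ ℚ._+_ (ℚₚ.∣p*q∣≡∣p∣*∣q∣ p (q ℚ.- s)) (ℚₚ.∣p*q∣≡∣p∣*∣q∣ s (p ℚ.- r)) ⟩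
    ℚ.∣ p ∣ ℚ.* ℚ.∣ q ℚ.- s ∣ ℚ.+ ℚ.∣ s ∣ ℚ.* ℚ.∣ p ℚ.- r ∣
      ≤⟨ ℚₚ.+-mono-≤
           (*-mono-nonNeg {ℚ.∣ p ∣} {ℚ.∣ q ℚ.- s ∣} {A} {δ} (ℚₚ.0≤∣p∣ (q ℚ.- s)) 0≤A p≤A q-s≤δ)
           (*-mono-nonNeg {ℚ.∣ s ∣} {ℚ.∣ p ℚ.- r ∣} {B} {δ} (ℚₚ.0≤∣p∣ (p ℚ.- r)) 0≤B s≤B p-r≤δ) ⟩
    A ℚ.* δ ℚ.+ B ℚ.* δ ∎
  where open ℚₚ.≤-Reasoning; open +-*-Solver

split-ε : ∀ {A B ε} → 0ℚ ℚ.< A → 0ℚ ℚ.< B → 0ℚ ℚ.< ε →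
  ∃[ δ ] (0ℚ ℚ.< δ × A ℚ.* δ ℚ.+ B ℚ.* δ ≡ ε)
split-ε {A} {B} {ε} 0<A 0<B 0<ε = ε ℚ.* i , 0<δ , (begin
    A ℚ.* (ε ℚ.* i) ℚ.+ B ℚ.* (ε ℚ.* i)
      ≡⟨ solve 4 (λ a b e i → a :* (e :* i) :+ b :* (e :* i) := e :* ((a :+ b) :* i))
           refl A B ε i ⟩
    ε ℚ.* ((A ℚ.+ B) ℚ.* i)
      ≡⟨ cong (ε ℚ.*_) (ℚₚ.*-inverseʳ (A ℚ.+ B) {{A+B≢0}}) ⟩
    ε ℚ.* 1ℚ
      ≡⟨ ℚₚ.*-identityʳ ε ⟩
    ε ∎)
  where
  open ≡-Reasoning; open +-*-Solver
  A+B>0 : ℚ.Positive (A ℚ.+ B)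
  A+B>0 = ℚ.positive (ℚₚ.+-mono-< 0<A 0<B)
  A+B≢0 : ℚ.NonZero (A ℚ.+ B)
  A+B≢0 = ℚₚ.pos⇒nonZero (A ℚ.+ B) {{A+B>0}}
  i : ℚ
  i = (ℚ.1/ (A ℚ.+ B)) {{A+B≢0}}
  0<i : 0ℚ ℚ.< i
  0<i = ℚₚ.positive⁻¹ i {{ℚₚ.1/pos⇒pos (A ℚ.+ B) {{A+B>0}}}}
  0<δ : 0ℚ ℚ.< ε ℚ.* i
  0<δ = subst (ℚ._< ε ℚ.* i) (ℚₚ.*-zeroʳ ε)
    (ℚₚ.*-monoʳ-<-pos ε {{ℚ.positive 0<ε}} {0ℚ} {i} 0<i)

*-cauchy : ∀ {x y} → IsCauchy x → IsCauchy y → IsCauchy (λ n → x n ℚ.* y n)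
*-cauchy {x} {y} cx cy ε 0<ε =
  let A , 0<A , N₁ , hA = eventually-bounded cx
      B , 0<B , N₂ , hB = eventually-bounded cy
      δ , 0<δ , splits  = split-ε {A} {B} {ε} 0<A 0<B 0<ε
      N₃ , h₃ = cx δ 0<δ
      N₄ , h₄ = cy δ 0<δ
      M₁ = N₁ ℕ.⊔ N₂
      M₂ = N₃ ℕ.⊔ N₄
  in M₁ ℕ.⊔ M₂ , λ m n N≤m N≤n →
    let M₁≤m = ℕₚ.m⊔n≤o⇒m≤o M₁ M₂ N≤m
        M₁≤n = ℕₚ.m⊔n≤o⇒m≤o M₁ M₂ N≤n
        M₂≤m = ℕₚ.m⊔n≤o⇒n≤o M₁ M₂ N≤m
        M₂≤n = ℕₚ.m⊔n≤o⇒n≤o M₁ M₂ N≤n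
    in subst (ℚ.∣ x m ℚ.* y m ℚ.- x n ℚ.* y n ∣ ℚ.≤_) splits
      (∣pq-rs∣-bound {x m} {y m} {x n} {y n} {A} {B} {δ} (ℚₚ.<⇒≤ 0<A) (ℚₚ.<⇒≤ 0<B)
        (hA m (ℕₚ.m⊔n≤o⇒m≤o N₁ N₂ M₁≤m)) (hB n (ℕₚ.m⊔n≤o⇒n≤o N₁ N₂ M₁≤n))
        (h₃ m n (ℕₚ.m⊔n≤o⇒m≤o N₃ N₄ M₂≤m) (ℕₚ.m⊔n≤o⇒m≤o N₃ N₄ M₂≤n))
        (h₄ m n (ℕₚ.m⊔n≤o⇒n≤o N₃ N₄ M₂≤m) (ℕₚ.m⊔n≤o⇒n≤o N₃ N₄ M₂≤n)))

_*_ : ℝ → ℝ → ℝ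
mkℝ x cx * mkℝ y cy = mkℝ (λ n → x n ℚ.* y n) (*-cauchy {x} {y} cx cy)

∑ : List ℝ → ℝ
∑ = foldr _+_ 0ℝ

2^⌊log₂n⌋≤n : ∀ n .{{_ : NonZero n}} → 2 ℕ.^ ⌊log₂ n ⌋ ℕ.≤ n
2^⌊log₂n⌋≤n n = <-rec (λ n → .{{_ : NonZero n}} → 2 ℕ.^ ⌊log₂ n ⌋ ℕ.≤ n) step n
  where
  2⌊n/2⌋≤n : ∀ n → 2 ℕ.* ℕ.⌊ n /2⌋ ℕ.≤ n
  2⌊n/2⌋≤n n = begin
    2 ℕ.* ℕ.⌊ n /2⌋               ≡⟨ cong (ℕ.⌊ n /2⌋ ℕ.+_) (ℕₚ.+-identityʳ _) ⟩
    ℕ.⌊ n /2⌋ ℕ.+ ℕ.⌊ n /2⌋       ≤⟨ ℕₚ.+-monoʳ-≤ ℕ.⌊ n /2⌋ (ℕₚ.⌊n/2⌋≤⌈n/2⌉ n) ⟩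
    ℕ.⌊ n /2⌋ ℕ.+ ℕ.⌈ n /2⌉       ≡⟨ ℕₚ.⌊n/2⌋+⌈n/2⌉≡n n ⟩
    n                             ∎
    where open ℕₚ.≤-Reasoning
  pow-pred : ∀ l → 2 ℕ.^ l ℕ.≤ 2 ℕ.* 2 ℕ.^ (l ℕ.∸ 1)
  pow-pred ℕ.zero = ℕ.s≤s ℕ.z≤n
  pow-pred (suc l) = ℕₚ.≤-refl
  step : ∀ n → (∀ {m} → m ℕ.< n → .{{_ : NonZero m}} → 2 ℕ.^ ⌊log₂ m ⌋ ℕ.≤ m) →
         .{{_ : NonZero n}} → 2 ℕ.^ ⌊log₂ n ⌋ ℕ.≤ n
  step 1 rec = ℕₚ.≤-refl
  step n@(suc (suc n')) rec = begin
    2 ℕ.^ ⌊log₂ n ⌋                   ≤⟨ pow-pred ⌊log₂ n ⌋ ⟩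
    2 ℕ.* 2 ℕ.^ (⌊log₂ n ⌋ ℕ.∸ 1)     ≡⟨ cong (λ l → 2 ℕ.* 2 ℕ.^ l) (⌊log₂⌊n/2⌋⌋≡⌊log₂n⌋∸1 n) ⟨
    2 ℕ.* 2 ℕ.^ ⌊log₂ ℕ.⌊ n /2⌋ ⌋     ≤⟨ ℕₚ.*-monoʳ-≤ 2 (rec (ℕₚ.⌊n/2⌋<n (suc n'))) ⟩
    2 ℕ.* ℕ.⌊ n /2⌋                   ≤⟨ 2⌊n/2⌋≤n n ⟩
    n                                 ∎
    where open ℕₚ.≤-Reasoning

n<2^[1+⌊log₂n⌋] : ∀ n → n ℕ.< 2 ℕ.^ suc ⌊log₂ n ⌋
n<2^[1+⌊log₂n⌋] n with n ℕ.<? 2 ℕ.^ suc ⌊log₂ n ⌋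
... | yes h = h
... | no  h = contradiction
  (subst (ℕ._≤ ⌊log₂ n ⌋) (⌊log₂[2^n]⌋≡n (suc ⌊log₂ n ⌋)) (⌊log₂⌋-mono-≤ (ℕₚ.≮⇒≥ h)))
  ℕₚ.1+n≰n

^-cancelʳ-< : ∀ {a b} → 2 ℕ.^ a ℕ.< 2 ℕ.^ b → a ℕ.< b
^-cancelʳ-< {a} {b} h with a ℕ.<? b
... | yes a<b = a<b
... | no  a≮b = contradiction (ℕₚ.^-monoʳ-≤ 2 (ℕₚ.≮⇒≥ a≮b)) (ℕₚ.<⇒≱ h)

⌊log₂⌋-ratio : ∀ n p q .{{_ : NonZero p}} .{{_ : NonZero q}} →
  ⌊log₂ (n ℕ.^ p) ⌋ ℕ.* q ℕ.≤ suc ⌊log₂ (n ℕ.^ q) ⌋ ℕ.* p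
⌊log₂⌋-ratio ℕ.zero (suc p) q = ℕ.z≤n
⌊log₂⌋-ratio n@(suc _) p q = ℕₚ.<⇒≤ (^-cancelʳ-< (begin-strict
    2 ℕ.^ (a ℕ.* q)         ≡⟨ ℕₚ.^-*-assoc 2 a q ⟨
    (2 ℕ.^ a) ℕ.^ q         ≤⟨ ℕₚ.^-monoˡ-≤ q (2^⌊log₂n⌋≤n (n ℕ.^ p) {{ℕₚ.m^n≢0 n p}}) ⟩
    (n ℕ.^ p) ℕ.^ q         ≡⟨ ℕₚ.^-*-assoc n p q ⟩
    n ℕ.^ (p ℕ.* q)         ≡⟨ cong (n ℕ.^_) (ℕₚ.*-comm p q) ⟩
    n ℕ.^ (q ℕ.* p)         ≡⟨ ℕₚ.^-*-assoc n q p ⟨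
    (n ℕ.^ q) ℕ.^ p         <⟨ ℕₚ.^-monoˡ-< p (n<2^[1+⌊log₂n⌋] (n ℕ.^ q)) ⟩
    (2 ℕ.^ suc b) ℕ.^ p     ≡⟨ ℕₚ.^-*-assoc 2 (suc b) p ⟩
    2 ℕ.^ (suc b ℕ.* p)     ∎))
  where
  open ℕₚ.≤-Reasoning
  a b : ℕ
  a = ⌊log₂ (n ℕ.^ p) ⌋
  b = ⌊log₂ (n ℕ.^ q) ⌋

frac-≤ : ∀ a b p q → a ℕ.* suc q ℕ.≤ suc b ℕ.* suc p →
  (+ a) ℚ./ suc p ℚ.≤ (+ b) ℚ./ suc q ℚ.+ (+ 1) ℚ./ suc q
frac-≤ a b p q h = ℚₚ.toℚᵘ-cancel-≤ (begin
    ℚ.toℚᵘ ((+ a) ℚ./ suc p)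
      ≃⟨ ℚₚ.toℚᵘ-fromℚᵘ (mkℚᵘ (+ a) p) ⟩
    mkℚᵘ (+ a) p
      ≤⟨ ℚᵘ.*≤* (subst₂ ℤ._≤_ (ℤₚ.pos-* a (suc q)) (ℤₚ.pos-* (suc b) (suc p)) (ℤ.+≤+ h)) ⟩
    mkℚᵘ (+ suc b) q
      ≃⟨ ℚᵘ.*≡* numerators ⟩
    mkℚᵘ (+ b) q ℚᵘ.+ mkℚᵘ (+ 1) q
      ≃⟨ ℚᵘₚ.+-cong (ℚₚ.toℚᵘ-fromℚᵘ (mkℚᵘ (+ b) q)) (ℚₚ.toℚᵘ-fromℚᵘ (mkℚᵘ (+ 1) q)) ⟨
    ℚ.toℚᵘ ((+ b) ℚ./ suc q) ℚᵘ.+ ℚ.toℚᵘ ((+ 1) ℚ./ suc q)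
      ≃⟨ ℚₚ.toℚᵘ-homo-+ ((+ b) ℚ./ suc q) ((+ 1) ℚ./ suc q) ⟨
    ℚ.toℚᵘ ((+ b) ℚ./ suc q ℚ.+ (+ 1) ℚ./ suc q) ∎)
  where
  open ℚᵘₚ.≤-Reasoning
  Q : ℤ.ℤ
  Q = + suc q
  numerators : (+ suc b) ℤ.* (Q ℤ.* Q) ≡ ((+ b) ℤ.* Q ℤ.+ (+ 1) ℤ.* Q) ℤ.* Q
  numerators = trans (sym (ℤₚ.*-assoc (+ suc b) Q Q)) (cong (ℤ._* Q)
    (trans (cong (ℤ._* Q) (cong +_ (sym (ℕₚ.+-comm b 1)))) (ℤₚ.*-distribʳ-+ Q (+ b) (+ 1))))

-- log₂ n = lim ⌊log₂ (n ^ m)⌋ / m, the m-th term being off by at most 1/m.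
-- Junk value: log₂ 0 = 0.
log₂ : ℕ → ℝ
log₂ n = mkℝ term λ ε 0<ε →
  let N , small = 1/[1+N]≤ε ε 0<ε
      one-sided : ∀ i j → N ℕ.≤ j → term i ℚ.≤ term j ℚ.+ ε
      one-sided i j N≤j = ℚₚ.≤-trans
        (frac-≤ ⌊log₂ (n ℕ.^ suc i) ⌋ ⌊log₂ (n ℕ.^ suc j) ⌋ i j (⌊log₂⌋-ratio n (suc i) (suc j)))
        (ℚₚ.+-monoʳ-≤ (term j) (small j N≤j))
  in N , λ i j N≤i N≤j → ∣p-q∣≤e (one-sided i j N≤j) (one-sided j i N≤i)
  where
  term : ℕ → ℚ
  term m = (+ ⌊log₂ (n ℕ.^ suc m) ⌋) ℚ./ suc m

record Metric (n : ℕ) : Set where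
  field
    d        : Fin n → Fin n → ℝ
    d-refl   : Definite _≡_ _≈_ d 0ℝ
    -- The usual constructive reading of "d x y ≈ 0 implies x ≡ y":
    -- distinct points lie at a distance bounded away from 0.
    d-pos    : ∀ {x y} → x ≢ y → 0ℝ < d x y
    d-sym    : Symmetric _≈_ d
    triangle : TriangleInequality _≤_ _+_ d

open Metric public

record Dist (A : Set) : Set where
  field
    support : List (A × ℝ)
    nonNeg  : All (λ (_ , p) → 0ℝ ≤ p) support
    total   : ∑ (map proj₂ support) ≈ 1ℝ

open Dist public

𝔼 : ∀ {A : Set} → Dist A → (A → ℝ) → ℝ
𝔼 μ f = ∑ (map (λ (a , p) → p * f a) (support μ))

-- The taxis are labelled; the labels play no role in the cost, so this
-- is the same as working with multisets of k points.
Config : ℕ → ℕ → Set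
Config k n = Vec (Fin n) k

record Request (n : ℕ) : Set where
  constructor _⇒_
  field
    source destination : Fin n

open Request public

-- How a request is served: every taxi j other than `taxi` repositions to
-- `lookup target j`, while `taxi` drives to the source of the request and
-- from there to its destination.  The entry of `target` at `taxi` is ignored.
record Move (k n : ℕ) : Set where
  constructor move
  field
    taxi   : Fin k
    target : Config k n

open Move public

module _ {k n : ℕ} where

  atPickup afterService : Request n → Move k n → Config k n
  atPickup     r a = target a [ taxi a ]≔ source r
  afterService r a = target a [ taxi a ]≔ destination r

  moveCost : Metric n → Config k n → Request n → Move k n → ℝ
  moveCost M C r a = ∑ (toList (zipWith (d M) C (atPickup r a)))

  scheduleCost : Metric n → Config k n → (σ : List (Request n)) → Vec (Move k n) (length σ) → ℝ
  scheduleCost M C []      []       = 0ℝ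
  scheduleCost M C (r ∷ σ) (a ∷ as) =
    moveCost M C r a + scheduleCost M (afterService r a) σ as

allVecs : ∀ {A : Set} → List A → (m : ℕ) → List (Vec A m)
allVecs xs ℕ.zero  = [] ∷ []
allVecs xs (suc m) = cartesianProductWith _∷_ xs (allVecs xs m)

allMoves : ∀ k n → List (Move k n)
allMoves k n = cartesianProductWith move (allFin k) (allVecs (allFin n) k)

-- The minimum of the costs of all schedules.  The fold needs a starting
-- value, for which we take the cost of one particular schedule.
OPT : ∀ {k n} .{{_ : NonZero k}} → Metric n → Config k n → List (Request n) → ℝ
OPT {k} {n} M C σ =
  foldr _⊓_ (scheduleCost M C σ (replicate (length σ) (move firstTaxi C)))
    (map (scheduleCost M C σ) (allVecs (allMoves k n) (length σ)))
  where
  firstTaxi : Fin k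
  firstTaxi = fromℕ< (ℕ.>-nonZero⁻¹ k)

-- A randomized online algorithm: its choices depend only on the initial
-- configuration, the requests seen so far, and its own past random choices,
-- all of which it may record in a memory of arbitrary type.
record OnlineAlgorithm (k n : ℕ) : Set₁ where
  field
    Memory : Set
    init   : Config k n → Dist Memory
    step   : Memory → Config k n → Request n → Dist (Move k n × Memory)

open OnlineAlgorithm public

module _ {k n : ℕ} (M : Metric n) (A : OnlineAlgorithm k n) where

  expectedCostFrom : Memory A → Config k n → List (Request n) → ℝ
  expectedCostFrom s C []      = 0ℝ
  expectedCostFrom s C (r ∷ σ) = 𝔼 (step A s C r) λ (a , s′) →
    moveCost M C r a + expectedCostFrom s′ (afterService r a) σ

  expectedCost : Config k n → List (Request n) → ℝ
  expectedCost C σ = 𝔼 (init A C) λ s → expectedCostFrom s C σ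

  -- The request sequence is fixed before any random choice is made, so the
  -- adversary is oblivious.
  Competitive : .{{_ : NonZero k}} → ℝ → Set
  Competitive ρ = ∀ (C₀ : Config k n) → ∃[ c ] (∀ (σ : List (Request n)) →
    expectedCost C₀ σ ≤ ρ * OPT M C₀ σ + c)

{-# OPTIONS --safe #-}
-- Round the metric to an integer metric q, up to a constant factor, and embed q
-- into a random ultrametric δ ≥ q with E δ(u,v) = O(log n) q(u,v)
-- (Fakcharoenphol, Rao, Talwar): at level i every point is assigned to the first
-- point, in a random order, within a random radius from [2^i, 2^(i+1)).
--
-- On an ultrametric, order the taxis by their distance x_j to the source of the
-- request and let taxi j serve with probability proportional to 2^(-j) / x_j.
-- The potential is 2^k times the cost of a matching between the taxis of the
-- algorithm and those of the adversary.  If taxi i is matched to the adversary's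
-- taxi at the source, then serving with taxi j changes the matching cost by at
-- most -x_i for j = i and max(0, x_j - x_i) otherwise, by the strong triangle
-- inequality, and 2^(-i) exceeds the sum of 2^(-j) over j > i.
module Submission where

open import Data.Bool using (if_then_else_)
open import Data.Fin using (Fin; zero; suc; toℕ; fromℕ<; punchIn; punchOut)
open import Data.Fin.Permutation using (Permutation′; _⟨$⟩ʳ_; _⟨$⟩ˡ_; _∘ₚ_; transpose; inverseˡ; inverseʳ) renaming (id to idₚ)
open import Data.Fin.Properties using (_≟_; all?; any?; toℕ<n; punchIn-punchOut; 0≢1+n; suc-injective)
open import Data.List using (List; []; _∷_; map; foldr; length; allFin; cartesianProductWith; concatMap; _++_)
open import Data.List.Membership.Propositional.Properties using (∈-allFin; ∈-map⁺)
open import Data.List.Properties using (map-cong; map-∘; map-++; map-tabulate)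
open import Data.List.Relation.Unary.All using (All; []; _∷_)
import Data.List.Relation.Unary.All as All
import Data.List.Relation.Unary.All.Properties as Allₚ
open import Data.Nat using (ℕ; zero; suc; NonZero; NonTrivial; _^_)
import Data.Nat as ℕ
open import Data.Nat.Divisibility using (_∣_; quotient)
open import Data.Nat.Induction using (<-rec)
open import Data.Nat.ListAction using (sum; product)
open import Data.Nat.ListAction.Properties using (sum-++; ∈⇒∣product; product≢0)
open import Data.Nat.Logarithm using (⌊log₂_⌋; ⌊log₂⌋-mono-≤; ⌊log₂[2^n]⌋≡n; ⌊log₂⌊n/2⌋⌋≡⌊log₂n⌋∸1)
import Data.Nat.Properties as ℕₚ
import Data.Nat.Solver as ℕ-Solver
open import Data.Product using (_×_; _,_; proj₁; proj₂; ∃-syntax)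
open import Data.Sum using (_⊎_; inj₁; inj₂)
open import Data.Unit using (⊤; tt)
open import Data.Vec using (Vec; []; _∷_; lookup; zipWith; toList; replicate; _[_]≔_)
open import Data.Vec.Properties using (lookup∘update; lookup∘update′)
open import Function using (_∘_; id)
open import Relation.Binary.PropositionalEquality using (_≡_; _≢_; refl; sym; trans; cong; cong₂; subst; subst₂; module ≡-Reasoning)
open import Relation.Nullary using (Dec; does; yes; no; ¬_; contradiction; _×-dec_)
open import Relation.Nullary.Decidable using (dec-true; dec-false)

-- The ride from source to destination is free and may be arbitrarily long, so the potential must
-- not depend on the destination. This dictates the rematching: after each request the two serving
-- taxis are partners, both stand at the destination, and their pair contributes 0.
--
-- Real distances are Cauchy sequences, whose order is undecidable, while balls, ranks and weights
-- all rest on comparisons. Hence the passage to integer distances. There the radii of a level are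
-- finite in number, and every expectation is a weighted sum of natural numbers; inequalities are
-- multiplied by the total weight, so that fractions occur only in the final transfer to ℝ.
--
-- The embedding is drawn once, before the first request. The adversary is oblivious, so its
-- schedule does not depend on the draw, and the expected length of the schedule grows by at most
-- the stretch of a single distance.

module Combinatorics where

  open import Algebra.Properties.CommutativeMonoid.Sum ℕₚ.+-0-commutativeMonoid using (sum-permute) renaming (sum to ⨁)
  open import Algebra.Properties.CommutativeSemigroup ℕₚ.+-commutativeSemigroup using (interchange)
  open import Data.Nat hiding (_≟_)
  open import Data.Nat.Properties hiding (_≟_; 0≢1+n; suc-injective)
  open import Data.Nat.Solver using (module +-*-Solver)

  private variable
    I I′ L : Set

  -- Finite sums of natural numbers

  sumOver : List I → (I → ℕ) → ℕ
  sumOver xs f = sum (map f xs)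

  sumOver-cong : ∀ (xs : List I) {f g} → (∀ x → f x ≡ g x) → sumOver xs f ≡ sumOver xs g
  sumOver-cong xs f≗g = cong sum (map-cong f≗g xs)

  sumOver-mono : ∀ (xs : List I) {f g} → (∀ x → f x ≤ g x) → sumOver xs f ≤ sumOver xs g
  sumOver-mono []       f≤g = z≤n
  sumOver-mono (x ∷ xs) f≤g = +-mono-≤ (f≤g x) (sumOver-mono xs f≤g)

  sumOver-+ : ∀ (xs : List I) f g → sumOver xs (λ x → f x + g x) ≡ sumOver xs f + sumOver xs g
  sumOver-+ []       f g = refl
  sumOver-+ (x ∷ xs) f g =
    trans (cong (f x + g x +_) (sumOver-+ xs f g)) (interchange (f x) (g x) (sumOver xs f) (sumOver xs g))

  sumOver-*ˡ : ∀ (xs : List I) c f → sumOver xs (λ x → c * f x) ≡ c * sumOver xs f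
  sumOver-*ˡ []       c f = sym (*-zeroʳ c)
  sumOver-*ˡ (x ∷ xs) c f =
    trans (cong (c * f x +_) (sumOver-*ˡ xs c f)) (sym (*-distribˡ-+ c (f x) (sumOver xs f)))

  sumOver-*ʳ : ∀ (xs : List I) f c → sumOver xs (λ x → f x * c) ≡ sumOver xs f * c
  sumOver-*ʳ []       f c = refl
  sumOver-*ʳ (x ∷ xs) f c =
    trans (cong (f x * c +_) (sumOver-*ʳ xs f c)) (sym (*-distribʳ-+ c (f x) (sumOver xs f)))

  sumOver-≡0 : ∀ (xs : List I) {f} → (∀ x → f x ≡ 0) → sumOver xs f ≡ 0
  sumOver-≡0 []       f≡0 = refl
  sumOver-≡0 (x ∷ xs) f≡0 = cong₂ _+_ (f≡0 x) (sumOver-≡0 xs f≡0)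

  sumOver-map : ∀ (h : I → I′) xs f → sumOver (map h xs) f ≡ sumOver xs (f ∘ h)
  sumOver-map h xs f = cong sum (sym (map-∘ xs))

  sumOver-++ : ∀ (xs ys : List I) f → sumOver (xs ++ ys) f ≡ sumOver xs f + sumOver ys f
  sumOver-++ xs ys f = trans (cong sum (map-++ f xs ys)) (sum-++ (map f xs) (map f ys))

  sumOver-× : ∀ (h : I → I′ → L) xs ys f →
    sumOver (cartesianProductWith h xs ys) f ≡ sumOver xs (λ x → sumOver ys (λ y → f (h x y)))
  sumOver-× h []       ys f = refl
  sumOver-× h (x ∷ xs) ys f = trans (sumOver-++ (map (h x) ys) _ f)
    (cong₂ _+_ (sumOver-map (h x) ys f) (sumOver-× h xs ys f))

  sumOver-swap : ∀ (xs : List I) (ys : List I′) (f : I → I′ → ℕ) →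
    sumOver xs (λ x → sumOver ys (f x)) ≡ sumOver ys (λ y → sumOver xs (λ x → f x y))
  sumOver-swap []       ys f = sym (sumOver-≡0 ys λ _ → refl)
  sumOver-swap (x ∷ xs) ys f = trans (cong (sumOver ys (f x) +_) (sumOver-swap xs ys f))
    (sym (sumOver-+ ys (f x) (λ y → sumOver xs (λ x′ → f x′ y))))

  sumOver-suc : ∀ {k} (f : Fin (suc k) → ℕ) →
    sumOver (allFin (suc k)) f ≡ f zero + sumOver (allFin k) (f ∘ suc)
  sumOver-suc f = cong (f zero +_)
    (cong sum (trans (map-tabulate suc f) (sym (map-tabulate id (f ∘ suc)))))

  sumOver-allFin-const : ∀ k c → sumOver (allFin k) (λ _ → c) ≡ k * c
  sumOver-allFin-const zero    c = refl
  sumOver-allFin-const (suc k) c = trans (sumOver-suc {k} (λ _ → c)) (cong (c +_) (sumOver-allFin-const k c))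

  sumOver-allFin : ∀ {k} (f : Fin k → ℕ) → sumOver (allFin k) f ≡ ⨁ f
  sumOver-allFin {zero}  f = refl
  sumOver-allFin {suc k} f = trans (sumOver-suc f) (cong (f zero +_) (sumOver-allFin (f ∘ suc)))

  sumOver-permute : ∀ {k} (f : Fin k → ℕ) (π : Permutation′ k) →
    sumOver (allFin k) (f ∘ (π ⟨$⟩ʳ_)) ≡ sumOver (allFin k) f
  sumOver-permute f π = trans (sumOver-allFin (f ∘ (π ⟨$⟩ʳ_)))
    (trans (sym (sum-permute f π)) (sym (sumOver-allFin f)))

  ≤sumOver : ∀ {k} (f : Fin k → ℕ) i → f i ≤ sumOver (allFin k) f
  ≤sumOver f zero    = subst (f zero ≤_) (sym (sumOver-suc f)) (m≤m+n (f zero) _)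
  ≤sumOver f (suc i) = subst (f (suc i) ≤_) (sym (sumOver-suc f))
    (≤-trans (≤sumOver (f ∘ suc) i) (m≤n+m _ (f zero)))

  sumOver-range : ∀ a b (g : ℕ → ℕ) → sumOver (allFin (a + b)) (g ∘ toℕ) ≡
    sumOver (allFin a) (g ∘ toℕ) + sumOver (allFin b) (λ z → g (a + toℕ z))
  sumOver-range zero    b g = refl
  sumOver-range (suc a) b g = begin
    sumOver (allFin (suc a + b)) (g ∘ toℕ)
      ≡⟨ sumOver-suc {a + b} (g ∘ toℕ) ⟩
    g 0 + sumOver (allFin (a + b)) (g ∘ suc ∘ toℕ)
      ≡⟨ cong (g 0 +_) (sumOver-range a b (g ∘ suc)) ⟩
    g 0 + (sumOver (allFin a) (g ∘ suc ∘ toℕ) + s)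
      ≡⟨ +-assoc (g 0) _ s ⟨
    g 0 + sumOver (allFin a) (g ∘ suc ∘ toℕ) + s
      ≡⟨ cong (_+ s) (sumOver-suc {a} (g ∘ toℕ)) ⟨
    sumOver (allFin (suc a)) (g ∘ toℕ) + s ∎
    where
    open ≡-Reasoning
    s = sumOver (allFin b) (λ z → g (suc a + toℕ z))

  𝟙 : ∀ {P : Set} → Dec P → ℕ
  𝟙 P? = if does P? then 1 else 0

  𝟙-yes : ∀ {P : Set} (P? : Dec P) → P → 𝟙 P? ≡ 1
  𝟙-yes (yes _) p = refl
  𝟙-yes (no ¬p) p = contradiction p ¬p

  𝟙-no : ∀ {P : Set} (P? : Dec P) → ¬ P → 𝟙 P? ≡ 0
  𝟙-no (yes p) ¬p = contradiction p ¬p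
  𝟙-no (no _)  ¬p = refl

  𝟙≤1 : ∀ {P : Set} (P? : Dec P) → 𝟙 P? ≤ 1
  𝟙≤1 (yes _) = ≤-refl
  𝟙≤1 (no _)  = z≤n

  sumOver-𝟙-unique : ∀ {k} {P : Fin k → Set} (P? : ∀ i → Dec (P i)) →
    (∀ i j → P i → P j → i ≡ j) → sumOver (allFin k) (𝟙 ∘ P?) ≤ 1
  sumOver-𝟙-unique {zero}  P? unique = z≤n
  sumOver-𝟙-unique {suc k} {P} P? unique = subst (_≤ 1) (sym (sumOver-suc (𝟙 ∘ P?))) (go (P? zero))
    where
    go : (d : Dec (P zero)) → 𝟙 d + sumOver (allFin k) (𝟙 ∘ P? ∘ suc) ≤ 1
    go (yes p) = ≤-reflexive (cong suc
      (sumOver-≡0 (allFin k) λ i → 𝟙-no (P? (suc i)) λ pi → contradiction (unique zero (suc i) p pi) 0≢1+n))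
    go (no _)  = sumOver-𝟙-unique (P? ∘ suc) λ i j pi pj → suc-injective (unique (suc i) (suc j) pi pj)

  𝟙-mono : ∀ {P Q : Set} (P? : Dec P) (Q? : Dec Q) → (P → Q) → 𝟙 P? ≤ 𝟙 Q?
  𝟙-mono (yes p) Q? P⇒Q = ≤-reflexive (sym (𝟙-yes Q? (P⇒Q p)))
  𝟙-mono (no _)  Q? P⇒Q = z≤n

  sumOver-𝟙-interval : ∀ R l h →
    sumOver (allFin R) (λ z → 𝟙 ((l ≤? toℕ z) ×-dec (toℕ z <? h))) ≤ h ∸ l
  sumOver-𝟙-interval R l zero = ≤-trans (≤-reflexive (sumOver-≡0 (allFin R) λ z →
    𝟙-no ((l ≤? toℕ z) ×-dec (toℕ z <? 0)) λ ())) z≤n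
  sumOver-𝟙-interval zero l (suc h) = z≤n
  sumOver-𝟙-interval (suc R) l (suc h) = subst (_≤ suc h ∸ l)
    (sym (sumOver-suc {R} (λ z → 𝟙 ((l ≤? toℕ z) ×-dec (toℕ z <? suc h))))) (go l)
    where
    go : ∀ l → 𝟙 ((l ≤? 0) ×-dec (0 <? suc h)) +
      sumOver (allFin R) (λ z → 𝟙 ((l ≤? suc (toℕ z)) ×-dec (suc (toℕ z) <? suc h))) ≤ suc h ∸ l
    go zero = s≤s (sumOver-𝟙-interval R 0 h)
    go (suc l) = ≤-trans
      (sumOver-mono (allFin R) λ z → 𝟙-mono
        ((suc l ≤? suc (toℕ z)) ×-dec (suc (toℕ z) <? suc h)) ((l ≤? toℕ z) ×-dec (toℕ z <? h))
        λ (l≤z , z<h) → s≤s⁻¹ l≤z , s≤s⁻¹ z<h)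
      (sumOver-𝟙-interval R l h)

  sumOver-concatMap : ∀ (h : I → List I′) xs f →
    sumOver (concatMap h xs) f ≡ sumOver xs (λ x → sumOver (h x) f)
  sumOver-concatMap h []       f = refl
  sumOver-concatMap h (x ∷ xs) f = trans (sumOver-++ (h x) (concatMap h xs) f)
    (cong (sumOver (h x) f +_) (sumOver-concatMap h xs f))

  n<2^n : ∀ m → m < 2 ^ m
  n<2^n zero    = s≤s z≤n
  n<2^n (suc m) = begin-strict
    suc m               ≤⟨ n<2^n m ⟩
    2 ^ m               <⟨ m<m+n (2 ^ m) (≤-trans (m^n>0 2 m) (m≤m+n (2 ^ m) 0)) ⟩
    2 ^ m + (2 ^ m + 0) ∎
    where open ≤-Reasoning

  -- Exchanging the changed entries crosswise avoids the truncated subtraction of ℕ.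
  sumOver-update : ∀ {k} (f g : Fin k → ℕ) i → (∀ l → l ≢ i → f l ≡ g l) →
    sumOver (allFin k) f + g i ≡ sumOver (allFin k) g + f i
  sumOver-update {suc k} f g zero agree = begin
    sumOver (allFin (suc k)) f + g zero ≡⟨ cong (_+ g zero) (sumOver-suc f) ⟩
    f zero + F + g zero                 ≡⟨ cong (λ t → f zero + t + g zero) (sumOver-cong (allFin k) λ l → agree (suc l) λ ()) ⟩
    f zero + G + g zero                 ≡⟨ +-comm (f zero + G) (g zero) ⟩
    g zero + (f zero + G)               ≡⟨ cong (g zero +_) (+-comm (f zero) G) ⟩
    g zero + (G + f zero)               ≡⟨ +-assoc (g zero) G (f zero) ⟨
    g zero + G + f zero                 ≡⟨ cong (_+ f zero) (sumOver-suc g) ⟨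
    sumOver (allFin (suc k)) g + f zero ∎
    where
    open ≡-Reasoning
    F = sumOver (allFin k) (f ∘ suc)
    G = sumOver (allFin k) (g ∘ suc)
  sumOver-update {suc k} f g (suc i) agree = begin
    sumOver (allFin (suc k)) f + g (suc i) ≡⟨ cong (_+ g (suc i)) (sumOver-suc f) ⟩
    f zero + F + g (suc i)                 ≡⟨ +-assoc (f zero) F (g (suc i)) ⟩
    f zero + (F + g (suc i))               ≡⟨ cong₂ _+_ (agree zero λ ())
                                                (sumOver-update (f ∘ suc) (g ∘ suc) i λ l l≢i → agree (suc l) (l≢i ∘ suc-injective)) ⟩
    g zero + (G + f (suc i))               ≡⟨ +-assoc (g zero) G (f (suc i)) ⟨
    g zero + G + f (suc i)                 ≡⟨ cong (_+ f (suc i)) (sumOver-suc g) ⟨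
    sumOver (allFin (suc k)) g + f (suc i) ∎
    where
    open ≡-Reasoning
    F = sumOver (allFin k) (f ∘ suc)
    G = sumOver (allFin k) (g ∘ suc)

  sumOver-single : ∀ {k} (f : Fin k → ℕ) i → (∀ l → l ≢ i → f l ≡ 0) → sumOver (allFin k) f ≡ f i
  sumOver-single {k} f i f≡0 = begin
    sumOver (allFin k) f                ≡⟨ +-identityʳ _ ⟨
    sumOver (allFin k) f + 0            ≡⟨ sumOver-update f (λ _ → 0) i f≡0 ⟩
    sumOver (allFin k) (λ _ → 0) + f i  ≡⟨ cong (_+ f i) (sumOver-≡0 (allFin k) λ _ → refl) ⟩
    f i                                 ∎
    where open ≡-Reasoning

  sumOver-update₂ : ∀ {k} (f g : Fin k → ℕ) i j → i ≢ j → (∀ l → l ≢ i → l ≢ j → f l ≡ g l) →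
    sumOver (allFin k) f + (g i + g j) ≡ sumOver (allFin k) g + (f i + f j)
  sumOver-update₂ {k} f g i j i≢j agree = begin
    Σf + (g i + g j)   ≡⟨ +-assoc Σf (g i) (g j) ⟨
    Σf + g i + g j     ≡⟨ cong (λ t → Σf + t + g j) h-i ⟨
    Σf + h i + g j     ≡⟨ cong (_+ g j) (sumOver-update f h i λ l l≢i → sym (h-off l l≢i)) ⟩
    Σh + f i + g j     ≡⟨ +-assoc Σh (f i) (g j) ⟩
    Σh + (f i + g j)   ≡⟨ cong (Σh +_) (+-comm (f i) (g j)) ⟩
    Σh + (g j + f i)   ≡⟨ +-assoc Σh (g j) (f i) ⟨
    Σh + g j + f i     ≡⟨ cong (_+ f i) (sumOver-update h g j h≗g) ⟩
    Σg + h j + f i     ≡⟨ cong (λ t → Σg + t + f i) (h-off j (i≢j ∘ sym)) ⟩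
    Σg + f j + f i     ≡⟨ +-assoc Σg (f j) (f i) ⟩
    Σg + (f j + f i)   ≡⟨ cong (Σg +_) (+-comm (f j) (f i)) ⟩
    Σg + (f i + f j)   ∎
    where
    open ≡-Reasoning
    h : Fin k → ℕ
    h l = if does (l ≟ i) then g i else f l
    h-i : h i ≡ g i
    h-i = cong (λ b → if b then g i else f i) (dec-true (i ≟ i) refl)
    h-off : ∀ l → l ≢ i → h l ≡ f l
    h-off l l≢i = cong (λ b → if b then g i else f l) (dec-false (l ≟ i) l≢i)
    h≗g : ∀ l → l ≢ j → h l ≡ g l
    h≗g l l≢j = cases (l ≟ i)
      where
      cases : Dec (l ≡ i) → h l ≡ g l
      cases (yes eq)  = trans (cong h eq) (trans h-i (cong g (sym eq)))
      cases (no l≢i) = trans (h-off l l≢i) (agree l l≢i l≢j)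
    Σf = sumOver (allFin k) f
    Σg = sumOver (allFin k) g
    Σh = sumOver (allFin k) h

  -- Random ultrametrics

  -- harmonic m = m! H_m, where H_m is the m-th harmonic number.
  harmonic : ℕ → ℕ
  harmonic zero    = 0
  harmonic (suc m) = suc m * harmonic m + m !

  -- Each of the terms 1/(m+1), ..., 1/(m+j) is at most 1/(m+1), so H_m ≤ b gives H_(m+j) ≤ b +
  -- j/(m+1). This is that estimate multiplied by (m+1) (m+j)!.
  harmonic-step : ∀ m b j → harmonic m ≤ m ! * b →
    suc m * harmonic (j + m) ≤ (j + m) ! * (suc m * b + j)
  harmonic-step m b zero    h = begin
    suc m * harmonic m     ≤⟨ *-monoʳ-≤ (suc m) h ⟩
    suc m * (m ! * b)      ≡⟨ solve 3 (λ s f b → s :* (f :* b) := f :* (s :* b :+ con 0)) refl (suc m) (m !) b ⟩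
    m ! * (suc m * b + 0)  ∎
    where
    open ≤-Reasoning
    open +-*-Solver
  harmonic-step m b (suc j) h = begin
    suc m * (suc (j + m) * harmonic (j + m) + f)
      ≡⟨ solve 4 (λ s t h f → s :* (t :* h :+ f) := t :* (s :* h) :+ s :* f) refl (suc m) (suc (j + m)) (harmonic (j + m)) f ⟩
    suc (j + m) * (suc m * harmonic (j + m)) + suc m * f
      ≤⟨ +-mono-≤ (*-monoʳ-≤ (suc (j + m)) (harmonic-step m b j h)) (*-monoˡ-≤ f (s≤s (m≤n+m m j))) ⟩
    suc (j + m) * (f * (suc m * b + j)) + suc (j + m) * f
      ≡⟨ solve 4 (λ t f a j → t :* (f :* (a :+ j)) :+ t :* f := t :* f :* (a :+ (con 1 :+ j))) refl (suc (j + m)) f (suc m * b) j ⟩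
    suc (j + m) * f * (suc m * b + suc j) ∎
    where
    open ≤-Reasoning
    open +-*-Solver
    f = (j + m) !

  ⌈n/2⌉≤1+⌊n/2⌋ : ∀ n → ⌈ n /2⌉ ≤ suc ⌊ n /2⌋
  ⌈n/2⌉≤1+⌊n/2⌋ n = ⌊n/2⌋-mono (n≤1+n (suc n))

  -- With m = ⌊n/2⌋, the ⌈n/2⌉ terms beyond the m-th are each at most 1/(m+1), and ⌈n/2⌉ ≤ m+1. So
  -- they add at most 1, which is what the logarithm gains from m to n.
  harmonic≤ : ∀ n → harmonic n ≤ n ! * suc ⌊log₂ n ⌋
  harmonic≤ = <-rec (λ n → harmonic n ≤ n ! * suc ⌊log₂ n ⌋) go
    where
    go : ∀ n → (∀ {m} → m < n → harmonic m ≤ m ! * suc ⌊log₂ m ⌋) → harmonic n ≤ n ! * suc ⌊log₂ n ⌋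
    go 0 rec = z≤n
    go 1 rec = s≤s z≤n
    go n@(suc (suc n′)) rec = *-cancelˡ-≤ (suc m) (begin
      suc m * harmonic n                        ≡⟨ cong (λ k → suc m * harmonic k) n≡j+m ⟩
      suc m * harmonic (j + m)                  ≤⟨ harmonic-step m (suc l) j (rec (⌊n/2⌋<n (suc n′))) ⟩
      (j + m) ! * (suc m * suc l + j)           ≡⟨ cong (λ k → k ! * (suc m * suc l + j)) n≡j+m ⟨
      n ! * (suc m * suc l + j)                 ≤⟨ *-monoʳ-≤ (n !) (+-monoʳ-≤ (suc m * suc l) (⌈n/2⌉≤1+⌊n/2⌋ n)) ⟩
      n ! * (suc m * suc l + suc m)             ≡⟨ solve 3 (λ f s l → f :* (s :* l :+ s) := s :* (f :* (con 1 :+ l))) refl (n !) (suc m) (suc l) ⟩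
      suc m * (n ! * suc (suc l))               ≡⟨ cong (λ k → suc m * (n ! * suc k)) suc-l ⟩
      suc m * (n ! * suc ⌊log₂ n ⌋)             ∎)
      where
      open ≤-Reasoning
      open +-*-Solver
      m = ⌊ n /2⌋
      j = ⌈ n /2⌉
      l = ⌊log₂ m ⌋
      n≡j+m : n ≡ j + m
      n≡j+m = trans (sym (⌊n/2⌋+⌈n/2⌉≡n n)) (+-comm m j)
      suc-l : suc l ≡ ⌊log₂ n ⌋
      suc-l = trans (cong suc (⌊log₂⌊n/2⌋⌋≡⌊log₂n⌋∸1 n))
        (m+[n∸m]≡n {1} {⌊log₂ n ⌋} (⌊log₂⌋-mono-≤ {2} {n} (s≤s (s≤s z≤n))))

  -- A Lehmer code for an ordering of m points: the position of the last point,
  -- followed by a code for the ordering of the other points.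
  Code : ℕ → Set
  Code zero    = ⊤
  Code (suc m) = Fin (suc m) × Code m

  codes : ∀ m → List (Code m)
  codes zero    = tt ∷ []
  codes (suc m) = cartesianProductWith _,_ (allFin (suc m)) (codes m)

  sumOver-codes-const : ∀ m c → sumOver (codes m) (λ _ → c) ≡ m ! * c
  sumOver-codes-const zero    c = refl
  sumOver-codes-const (suc m) c = begin
    sumOver (codes (suc m)) (λ _ → c)                 ≡⟨ sumOver-× _,_ (allFin (suc m)) (codes m) (λ _ → c) ⟩
    sumOver (allFin (suc m)) (λ _ → sumOver (codes m) (λ _ → c))
      ≡⟨ sumOver-cong (allFin (suc m)) (λ _ → sumOver-codes-const m c) ⟩
    sumOver (allFin (suc m)) (λ _ → m ! * c)          ≡⟨ sumOver-allFin-const (suc m) (m ! * c) ⟩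
    suc m * (m ! * c)                                 ≡⟨ *-assoc (suc m) (m !) c ⟨
    (suc m) ! * c                                     ∎
    where open ≡-Reasoning

  record Ultrametric (n : ℕ) : Set where
    field
      δ       : Fin n → Fin n → ℕ
      δ-refl  : ∀ x → δ x x ≡ 0
      δ-sym   : ∀ x y → δ x y ≡ δ y x
      δ-ultra : ∀ x y z → δ x z ≤ δ x y ⊔ δ y z

  open Ultrametric public

  module _ {n : ℕ} (q : Fin n → Fin n → ℕ) where

    -- The hierarchy grows from the smallest scale upwards. Points farther apart than 4 * 2^i are
    -- left for coarser levels to separate, so domination is required only up to that scale; `δ≤`
    -- ensures that every coarser level assigns a larger distance.
    record Stage (i : ℕ) : Set where
      field
        um  : Ultrametric n
        δ≤  : ∀ x y → δ um x y ≤ 4 * 2 ^ i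
        q≤δ : ∀ x y → q x y ≤ 4 * 2 ^ i → q x y ≤ δ um x y

    record Dominating : Set where
      field
        metric    : Ultrametric n
        dominates : ∀ x y → q x y ≤ δ metric x y

    -- The first point x in the ordering such that q u x ≤ r, or a if there is none.
    -- The code lists the points backwards, so the point found last wins.
    label : ∀ {m} → ℕ → Fin n → Fin n → (Fin m → Fin n) → Code m → Fin n
    label {zero}  r u a xs _       = a
    label {suc m} r u a xs (i , c) =
      label r u (if does (q u (xs i) ≤? r) then xs i else a) (xs ∘ punchIn i) c

    label-near : ∀ {m} r u a (xs : Fin m → Fin n) c → q u a ≤ r → q u (label r u a xs c) ≤ r
    label-near {zero}  r u a xs _       h = h
    label-near {suc m} r u a xs (i , c) h = label-near r u _ (xs ∘ punchIn i) c (near (q u (xs i) ≤? r))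
      where
      near : (d : Dec (q u (xs i) ≤ r)) → q u (if does d then xs i else a) ≤ r
      near (yes h′) = h′
      near (no  _)  = h

    module _ (u v : Fin n) where

      lo hi : Fin n → ℕ
      lo x = q u x ⊓ q v x
      hi x = q u x ⊔ q v x

      -- If u and v get different labels at radius r, then the first point x of the
      -- ordering such that lo x ≤ r satisfies r < hi x.  All points before it
      -- have a larger lo, so x is a record.
      first? : ∀ {m} (xs : Fin (suc m) → Fin n) i → Dec (∀ j → lo (xs i) < lo (xs (punchIn i j)))
      first? xs i = all? (λ j → lo (xs i) <? lo (xs (punchIn i j)))

      between? : ∀ r x → Dec (lo x ≤ r × r < hi x)
      between? r x = (lo x ≤? r) ×-dec (r <? hi x)

      records : ∀ {m} → (Fin m → Fin n) → Code m → ℕ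
      records {zero}  xs _       = 0
      records {suc m} xs (i , c) = 𝟙 (first? xs i) + records (xs ∘ punchIn i) c

      -- A bound for the event that radius `r` separates `u` and `v`, in which the ordering and the
      -- radius enter through separate factors, so that each can be averaged on its own.
      hits : ∀ {m} → ℕ → (Fin m → Fin n) → Code m → ℕ
      hits {zero}  r xs _       = 0
      hits {suc m} r xs (i , c) =
        𝟙 (first? xs i) * 𝟙 (between? r (xs i)) + hits r (xs ∘ punchIn i) c

      -- Induction from the back of the ordering; the defaults `a` and `b` are the labels decided by
      -- the later points. Suppose that no point before `x` is within `r` of `u` or `v`. If `x` is
      -- within `r` of both, the defaults become equal; if of exactly one, `x` is a hit; if of
      -- neither, the defaults pass through.
      separated : ∀ {m} r a b (xs : Fin m → Fin n) c → label r u a xs c ≢ label r v b xs c →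
        1 ≤ hits r xs c ⊎ ((∀ j → r < lo (xs j)) × a ≢ b)
      separated {zero}  r a b xs _       ne = inj₂ ((λ ()) , ne)
      separated {suc m} r a b xs (i , c) ne =
        go (q u x ≤? r) (q v x ≤? r) (separated r _ _ (xs ∘ punchIn i) c ne)
        where
        x = xs i

        hit : (∀ j → r < lo (xs (punchIn i j))) → lo x ≤ r → r < hi x → 1 ≤ hits r xs (i , c)
        hit above lo≤ <hi = ≤-trans (≤-reflexive (sym (cong₂ _*_
          (𝟙-yes (first? xs i) (λ j → ≤-<-trans lo≤ (above j)))
          (𝟙-yes (between? r x) (lo≤ , <hi))))) (m≤m+n _ _)

        extend : r < lo x → (∀ j → r < lo (xs (punchIn i j))) → ∀ j → r < lo (xs j)
        extend here above j with i ≟ j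
        ... | yes refl = here
        ... | no i≢j   = subst (λ j → r < lo (xs j)) (punchIn-punchOut i≢j) (above (punchOut i≢j))

        go : (u? : Dec (q u x ≤ r)) (v? : Dec (q v x ≤ r)) →
             1 ≤ hits r (xs ∘ punchIn i) c ⊎ ((∀ j → r < lo (xs (punchIn i j))) ×
               (if does u? then x else a) ≢ (if does v? then x else b)) →
             1 ≤ hits r xs (i , c) ⊎ ((∀ j → r < lo (xs j)) × a ≢ b)
        go _ _ (inj₁ h) = inj₁ (≤-trans h (m≤n+m _ _))
        go (yes _)  (yes _)  (inj₂ (above , a≢b)) = contradiction refl a≢b
        go (yes u≤) (no v≰)  (inj₂ (above , a≢b)) =
          inj₁ (hit above (≤-trans (m⊓n≤m _ _) u≤) (<-≤-trans (≰⇒> v≰) (m≤n⊔m _ _)))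
        go (no u≰)  (yes v≤) (inj₂ (above , a≢b)) =
          inj₁ (hit above (≤-trans (m⊓n≤n _ _) v≤) (<-≤-trans (≰⇒> u≰) (m≤m⊔n _ _)))
        go (no u≰)  (no v≰)  (inj₂ (above , a≢b)) =
          inj₂ (extend (⊓-pres-m< (≰⇒> u≰) (≰⇒> v≰)) above , a≢b)

      -- Since the inequality in `first?` is strict, at most one of the m+1 candidates for the last
      -- position is a record there. So the last point is a record with probability at most 1/(m+1),
      -- and these probabilities add up to the harmonic number.
      Σrecords≤ : ∀ {m} (xs : Fin m → Fin n) → sumOver (codes m) (records xs) ≤ harmonic m
      Σrecords≤ {zero}  xs = z≤n
      Σrecords≤ {suc m} xs = begin
        sumOver (codes (suc m)) (records xs)
          ≡⟨ sumOver-× _,_ (allFin (suc m)) (codes m) (records xs) ⟩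
        sumOver (allFin (suc m)) (λ i → sumOver (codes m) (λ c → 𝟙 (first? xs i) + records (xs ∘ punchIn i) c))
          ≤⟨ sumOver-mono (allFin (suc m)) (λ i → ≤-trans (≤-reflexive (inner i)) (+-monoʳ-≤ _ (Σrecords≤ (xs ∘ punchIn i)))) ⟩
        sumOver (allFin (suc m)) (λ i → m ! * 𝟙 (first? xs i) + harmonic m)
          ≡⟨ sumOver-+ (allFin (suc m)) (λ i → m ! * 𝟙 (first? xs i)) (λ _ → harmonic m) ⟩
        sumOver (allFin (suc m)) (λ i → m ! * 𝟙 (first? xs i)) + sumOver (allFin (suc m)) (λ _ → harmonic m)
          ≡⟨ cong₂ _+_ (sumOver-*ˡ (allFin (suc m)) (m !) (𝟙 ∘ first? xs))
               (sumOver-allFin-const (suc m) (harmonic m)) ⟩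
        m ! * sumOver (allFin (suc m)) (𝟙 ∘ first? xs) + suc m * harmonic m
          ≤⟨ +-monoˡ-≤ _ (*-monoʳ-≤ (m !) (sumOver-𝟙-unique (first? xs) unique)) ⟩
        m ! * 1 + suc m * harmonic m
          ≡⟨ trans (cong (_+ suc m * harmonic m) (*-identityʳ (m !))) (+-comm (m !) (suc m * harmonic m)) ⟩
        harmonic (suc m) ∎
        where
        open ≤-Reasoning
        inner : ∀ i → sumOver (codes m) (λ c → 𝟙 (first? xs i) + records (xs ∘ punchIn i) c) ≡
                      m ! * 𝟙 (first? xs i) + sumOver (codes m) (records (xs ∘ punchIn i))
        inner i = trans (sumOver-+ (codes m) (λ _ → 𝟙 (first? xs i)) (records (xs ∘ punchIn i)))
          (cong (_+ sumOver (codes m) (records (xs ∘ punchIn i))) (sumOver-codes-const m (𝟙 (first? xs i))))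
        below : ∀ i j → (∀ j → lo (xs i) < lo (xs (punchIn i j))) → i ≢ j → lo (xs i) < lo (xs j)
        below i j h i≢j = subst (λ j → lo (xs i) < lo (xs j)) (punchIn-punchOut i≢j) (h (punchOut i≢j))
        unique : ∀ i j → (∀ l → lo (xs i) < lo (xs (punchIn i l))) →
                 (∀ l → lo (xs j) < lo (xs (punchIn j l))) → i ≡ j
        unique i j hi hj with i ≟ j
        ... | yes i≡j = i≡j
        ... | no i≢j  = contradiction (below j i hj (i≢j ∘ sym)) (<⇒≯ (below i j hi i≢j))

    module _ (q-refl : ∀ x → q x x ≡ 0) (q-pos : ∀ {x y} → x ≢ y → 1 ≤ q x y)
             (q-sym : ∀ x y → q x y ≡ q y x) (q-tri : ∀ x y z → q x z ≤ q x y + q y z) where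

      -- The radii that hit a given record form the interval from `lo` to `hi`, whose length is at
      -- most `q u v` by the triangle inequality.
      Σhits≤ : ∀ u v {m} R (xs : Fin m → Fin n) c →
        sumOver (allFin R) (λ z → hits u v (toℕ z) xs c) ≤ records u v xs c * q u v
      Σhits≤ u v {zero}  R xs _ = ≤-reflexive (sumOver-≡0 (allFin R) λ _ → refl)
      Σhits≤ u v {suc m} R xs (i , c) = begin
        sumOver (allFin R) (λ z → w * 𝟙 (between? u v (toℕ z) x) + hits u v (toℕ z) xs′ c)
          ≡⟨ sumOver-+ (allFin R) (λ z → w * 𝟙 (between? u v (toℕ z) x)) (λ z → hits u v (toℕ z) xs′ c) ⟩
        sumOver (allFin R) (λ z → w * 𝟙 (between? u v (toℕ z) x)) + sumOver (allFin R) (λ z → hits u v (toℕ z) xs′ c)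
          ≡⟨ cong (_+ sumOver (allFin R) (λ z → hits u v (toℕ z) xs′ c))
               (sumOver-*ˡ (allFin R) w (λ z → 𝟙 (between? u v (toℕ z) x))) ⟩
        w * sumOver (allFin R) (λ z → 𝟙 (between? u v (toℕ z) x)) + sumOver (allFin R) (λ z → hits u v (toℕ z) xs′ c)
          ≤⟨ +-mono-≤ (*-monoʳ-≤ w (≤-trans (sumOver-𝟙-interval R (lo u v x) (hi u v x)) hi∸lo≤q)) (Σhits≤ u v R xs′ c) ⟩
        w * q u v + records u v xs′ c * q u v
          ≡⟨ *-distribʳ-+ (q u v) w (records u v xs′ c) ⟨
        (w + records u v xs′ c) * q u v ∎
        where
        open ≤-Reasoning
        x   = xs i
        xs′ = xs ∘ punchIn i
        w   = 𝟙 (first? u v xs i)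
        hi∸lo≤q : hi u v x ∸ lo u v x ≤ q u v
        hi∸lo≤q = m≤n+o⇒m∸n≤o _ (lo u v x) (subst (hi u v x ≤_) (sym (+-distribʳ-⊓ (q u v) (q u x) (q v x))) (⊔-lub
          (⊓-glb (m≤m+n _ _) (≤-trans (q-tri u v x) (≤-reflexive (+-comm (q u v) (q v x)))))
          (⊓-glb (≤-trans (q-tri v u x) (≤-reflexive (trans (cong (_+ q u x) (q-sym v u)) (+-comm (q u v) (q u x)))))
                 (m≤m+n _ _))))

      -- The value 4 is the scale 4 * 2^0 of this stage, so domination off the diagonal is the
      -- hypothesis itself. Since distinct points have q ≥ 1, the stretch is at most 4.
      base : Stage 0
      base = record
        { um = record
          { δ       = λ x y → dist (x ≟ y)
          ; δ-refl  = λ x → refl′ (x ≟ x)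
          ; δ-sym   = λ x y → sym′ (x ≟ y) (y ≟ x)
          ; δ-ultra = λ x y z → ultra (x ≟ y) (y ≟ z) (x ≟ z)
          }
        ; δ≤  = λ x y → ≤4 (x ≟ y)
        ; q≤δ = λ x y → dominated (x ≟ y)
        }
        where
        dist : ∀ {x y : Fin n} → Dec (x ≡ y) → ℕ
        dist x≟y = if does x≟y then 0 else 4
        ≤4 : ∀ {x y} (d : Dec (x ≡ y)) → dist d ≤ 4
        ≤4 (yes _) = z≤n
        ≤4 (no _)  = ≤-refl
        refl′ : ∀ {x} (d : Dec (x ≡ x)) → dist d ≡ 0
        refl′ (yes _)  = refl
        refl′ (no x≢x) = contradiction refl x≢x
        sym′ : ∀ {x y} (d : Dec (x ≡ y)) (e : Dec (y ≡ x)) → dist d ≡ dist e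
        sym′ (yes _)   (yes _)   = refl
        sym′ (yes x≡y) (no y≢x)  = contradiction (sym x≡y) y≢x
        sym′ (no x≢y)  (yes y≡x) = contradiction (sym y≡x) x≢y
        sym′ (no _)    (no _)    = refl
        ultra : ∀ {x y z} (d : Dec (x ≡ y)) (e : Dec (y ≡ z)) (f : Dec (x ≡ z)) → dist f ≤ dist d ⊔ dist e
        ultra (no _)     e          f = ≤-trans (≤4 f) (m≤m⊔n 4 (dist e))
        ultra (yes _)    (no _)     f = ≤4 f
        ultra (yes refl) (yes refl) f = ≤-reflexive (refl′ f)
        dominated : ∀ {x y} (d : Dec (x ≡ y)) → q x y ≤ 4 → q x y ≤ dist d
        dominated (yes refl) _ = ≤-reflexive (q-refl _)
        dominated (no _)     h = h

      -- 4 * 2 ^ suc i bounds all distances of stage i, which gives the strong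
      -- triangle inequality.
      separatedDist : ∀ {x y : Fin n} → ℕ → Dec (x ≡ y) → ℕ → ℕ
      separatedDist i x≟y e = if does x≟y then e else 4 * 2 ^ suc i

      4*2^i≤ : ∀ i → 4 * 2 ^ i ≤ 4 * 2 ^ suc i
      4*2^i≤ i = *-monoʳ-≤ 4 (^-monoʳ-≤ 2 (n≤1+n i))

      -- Two points with a common centre are both within 2 * 2^i of it, hence at distance at most 4
      -- * 2^i: the range in which the previous stage already dominates.
      refine : ∀ {i r} → r ≤ 2 * 2 ^ i → (f : Fin n → Fin n) → (∀ x → q x (f x) ≤ r) → Stage i → Stage (suc i)
      refine {i} {r} r≤ f near s = record
        { um = record
          { δ       = λ x y → separatedDist i (f x ≟ f y) (δ (um s) x y)
          ; δ-refl  = λ x → refl′ x (f x ≟ f x)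
          ; δ-sym   = λ x y → sym′ x y (f x ≟ f y) (f y ≟ f x)
          ; δ-ultra = λ x y z → ultra x y z (f x ≟ f y) (f y ≟ f z) (f x ≟ f z)
          }
        ; δ≤  = λ x y → below x y (f x ≟ f y)
        ; q≤δ = λ x y → dominated x y (f x ≟ f y)
        }
        where
        open Stage
        below : ∀ x y (d : Dec (f x ≡ f y)) → separatedDist i d (δ (um s) x y) ≤ 4 * 2 ^ suc i
        below x y (yes _) = ≤-trans (δ≤ s x y) (4*2^i≤ i)
        below x y (no _)  = ≤-refl
        refl′ : ∀ x (d : Dec (f x ≡ f x)) → separatedDist i d (δ (um s) x x) ≡ 0
        refl′ x (yes _) = δ-refl (um s) x
        refl′ x (no ne) = contradiction refl ne
        sym′ : ∀ x y (d : Dec (f x ≡ f y)) (e : Dec (f y ≡ f x)) →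
          separatedDist i d (δ (um s) x y) ≡ separatedDist i e (δ (um s) y x)
        sym′ x y (yes _)  (yes _)  = δ-sym (um s) x y
        sym′ x y (yes eq) (no ne)  = contradiction (sym eq) ne
        sym′ x y (no ne)  (yes eq) = contradiction (sym eq) ne
        sym′ x y (no _)   (no _)   = refl
        ultra : ∀ x y z (d : Dec (f x ≡ f y)) (e : Dec (f y ≡ f z)) (g : Dec (f x ≡ f z)) →
          separatedDist i g (δ (um s) x z) ≤ separatedDist i d (δ (um s) x y) ⊔ separatedDist i e (δ (um s) y z)
        ultra x y z (no _)   e        g        = ≤-trans (below x z g) (m≤m⊔n (4 * 2 ^ suc i) _)
        ultra x y z (yes _)  (no _)   g        = ≤-trans (below x z g) (m≤n⊔m (δ (um s) x y) _)
        ultra x y z (yes _)  (yes _)  (yes _)  = δ-ultra (um s) x y z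
        ultra x y z (yes xy) (yes yz) (no ne)  = contradiction (trans xy yz) ne
        dominated : ∀ x y (d : Dec (f x ≡ f y)) → q x y ≤ 4 * 2 ^ suc i → q x y ≤ separatedDist i d (δ (um s) x y)
        dominated x y (no _)   h = h
        dominated x y (yes eq) _ = q≤δ s x y (begin
          q x y                       ≤⟨ q-tri x (f x) y ⟩
          q x (f x) + q (f x) y       ≡⟨ cong (q x (f x) +_) (trans (q-sym (f x) y) (cong (q y) eq)) ⟩
          q x (f x) + q y (f y)       ≤⟨ +-mono-≤ (≤-trans (near x) r≤) (≤-trans (near y) r≤) ⟩
          2 * 2 ^ i + 2 * 2 ^ i       ≡⟨ solve 1 (λ t → con 2 :* t :+ con 2 :* t := con 4 :* t) refl (2 ^ i) ⟩
          4 * 2 ^ i                   ∎)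
          where
          open ≤-Reasoning
          open +-*-Solver

      radius : ∀ i → Fin (2 ^ i) → ℕ
      radius i z = 2 ^ i + toℕ z

      radius≤ : ∀ i z → radius i z ≤ 2 * 2 ^ i
      radius≤ i z = +-monoʳ-≤ (2 ^ i) (≤-trans (<⇒≤ (toℕ<n z)) (≤-reflexive (sym (+-identityʳ (2 ^ i)))))

      centre : Code n → ℕ → Fin n → Fin n
      centre c r x = label r x x id c

      centre-near : ∀ c r x → q x (centre c r x) ≤ r
      centre-near c r x = label-near r x x id c (≤-trans (≤-reflexive (q-refl x)) z≤n)

      -- One ordering is shared by all levels, while the radii are drawn independently. The list
      -- runs through all combinations of radii, so averages over it are expectations.
      stages : Code n → ∀ i → List (Stage i)
      stages c zero    = base ∷ []
      stages c (suc i) = cartesianProductWith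
        (λ z → refine (radius≤ i z) (centre c (radius i z)) (centre-near c (radius i z)))
        (allFin (2 ^ i)) (stages c i)

      #stages : ℕ → ℕ
      #stages zero    = 1
      #stages (suc i) = 2 ^ i * #stages i

      sumOver-stages-const : ∀ c i k → sumOver (stages c i) (λ _ → k) ≡ #stages i * k
      sumOver-stages-const c zero    k = refl
      sumOver-stages-const c (suc i) k = begin
        sumOver (stages c (suc i)) (λ _ → k)
          ≡⟨ sumOver-× _ (allFin (2 ^ i)) (stages c i) (λ _ → k) ⟩
        sumOver (allFin (2 ^ i)) (λ _ → sumOver (stages c i) (λ _ → k))
          ≡⟨ sumOver-cong (allFin (2 ^ i)) (λ _ → sumOver-stages-const c i k) ⟩
        sumOver (allFin (2 ^ i)) (λ _ → #stages i * k)
          ≡⟨ sumOver-allFin-const (2 ^ i) (#stages i * k) ⟩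
        2 ^ i * (#stages i * k)
          ≡⟨ *-assoc (2 ^ i) (#stages i) k ⟨
        #stages (suc i) * k ∎
        where open ≡-Reasoning

      separation≤hits : ∀ u v c r i e →
        separatedDist i (centre c r u ≟ centre c r v) e ≤ e + 4 * 2 ^ suc i * hits u v r id c
      separation≤hits u v c r i e = go (centre c r u ≟ centre c r v)
        where
        go : (d : Dec (centre c r u ≡ centre c r v)) → separatedDist i d e ≤ e + 4 * 2 ^ suc i * hits u v r id c
        go (yes _) = m≤m+n e _
        go (no ne) with separated u v r u v id c ne
        ... | inj₁ h           = ≤-trans (≤-trans (≤-reflexive (sym (*-identityʳ _))) (*-monoʳ-≤ (4 * 2 ^ suc i) h)) (m≤n+m _ e)
        -- The point `u` is itself in the ordering and its `lo` is 0, so some point is always within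
        -- the radius.
        ... | inj₂ (above , _) = contradiction
          (<-≤-trans (above u) (≤-trans (m⊓n≤m _ _) (≤-reflexive (q-refl u)))) n≮0

      -- The radius of level i is uniform on [2^i, 2^(i+1)), so a separation there,
      -- which costs 8 * 2^i, contributes 8 times the number of separating radii in
      -- that interval; over all levels every radius is counted once.
      Σstages≤ : ∀ u v c i → sumOver (stages c i) (λ s → δ (Stage.um s) u v) ≤
        #stages i * (4 * q u v + 8 * sumOver (allFin (2 ^ i)) (λ z → hits u v (toℕ z) id c))
      Σstages≤ u v c zero = ≤-trans (go (u ≟ v)) (≤-trans (m≤m+n (4 * q u v) _) (≤-reflexive (sym (*-identityˡ _))))
        where
        go : (d : Dec (u ≡ v)) → (if does d then 0 else 4) + 0 ≤ 4 * q u v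
        go (yes _) = z≤n
        go (no ne) = *-monoʳ-≤ 4 (q-pos ne)
      Σstages≤ u v c (suc i) = begin
        sumOver (stages c (suc i)) (λ s → δ (Stage.um s) u v)
          ≡⟨ sumOver-× _ (allFin (2 ^ i)) (stages c i) (λ s → δ (Stage.um s) u v) ⟩
        sumOver (allFin (2 ^ i)) (λ z → sumOver (stages c i) (λ s →
          separatedDist i (centre c (radius i z) u ≟ centre c (radius i z) v) (δ (Stage.um s) u v)))
          ≤⟨ sumOver-mono (allFin (2 ^ i)) (λ z → ≤-trans
               (sumOver-mono (stages c i) λ s → separation≤hits u v c (radius i z) i (δ (Stage.um s) u v))
               (≤-reflexive (trans (sumOver-+ (stages c i) (λ s → δ (Stage.um s) u v) (λ _ → 4 * 2 ^ suc i * h z))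
                 (cong (D +_) (sumOver-stages-const c i (4 * 2 ^ suc i * h z)))))) ⟩
        sumOver (allFin (2 ^ i)) (λ z → D + #stages i * (4 * 2 ^ suc i * h z))
          ≡⟨ sumOver-+ (allFin (2 ^ i)) (λ _ → D) (λ z → #stages i * (4 * 2 ^ suc i * h z)) ⟩
        sumOver (allFin (2 ^ i)) (λ _ → D) + sumOver (allFin (2 ^ i)) (λ z → #stages i * (4 * 2 ^ suc i * h z))
          ≡⟨ cong₂ _+_ (sumOver-allFin-const (2 ^ i) D)
               (trans (sumOver-*ˡ (allFin (2 ^ i)) (#stages i) (λ z → 4 * 2 ^ suc i * h z))
                 (cong (#stages i *_) (sumOver-*ˡ (allFin (2 ^ i)) (4 * 2 ^ suc i) h))) ⟩
        2 ^ i * D + #stages i * (4 * 2 ^ suc i * Σh)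
          ≤⟨ +-monoˡ-≤ _ (*-monoʳ-≤ (2 ^ i) (Σstages≤ u v c i)) ⟩
        2 ^ i * (#stages i * (4 * q u v + 8 * Σg)) + #stages i * (4 * 2 ^ suc i * Σh)
          ≡⟨ solve 5 (λ t N q g h → t :* (N :* (con 4 :* q :+ con 8 :* g)) :+ N :* (con 4 :* (con 2 :* t) :* h)
               := t :* N :* (con 4 :* q :+ con 8 :* (g :+ h))) refl (2 ^ i) (#stages i) (q u v) Σg Σh ⟩
        2 ^ i * #stages i * (4 * q u v + 8 * (Σg + Σh))
          ≡⟨ cong (λ t → 2 ^ i * #stages i * (4 * q u v + 8 * t)) (trans
               (cong (λ b → sumOver (allFin (2 ^ i + b)) (λ z → hits u v (toℕ z) id c)) (+-identityʳ (2 ^ i)))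
               (sumOver-range (2 ^ i) (2 ^ i) (λ r → hits u v r id c))) ⟨
        #stages (suc i) * (4 * q u v + 8 * sumOver (allFin (2 ^ suc i)) (λ z → hits u v (toℕ z) id c)) ∎
        where
        open ≤-Reasoning
        open +-*-Solver
        h : Fin (2 ^ i) → ℕ
        h z = hits u v (radius i z) id c
        D  = sumOver (stages c i) (λ s → δ (Stage.um s) u v)
        Σh = sumOver (allFin (2 ^ i)) h
        Σg = sumOver (allFin (2 ^ i)) (λ z → hits u v (toℕ z) id c)

      -- The number of levels. A bound as crude as the sum of all distances is affordable, since the
      -- stretch does not grow with the number of levels.
      Σq : ℕ
      Σq = sumOver (allFin n) (λ x → sumOver (allFin n) (q x))

      dominating : Stage Σq → Dominating
      dominating s = record
        { metric    = Stage.um s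
        ; dominates = λ x y → Stage.q≤δ s x y (≤-trans (q≤Σq x y) (≤-trans (<⇒≤ (n<2^n Σq)) (m≤n*m _ 4)))
        }
        where
        q≤Σq : ∀ x y → q x y ≤ Σq
        q≤Σq x y = ≤-trans (≤sumOver (q x) y) (≤sumOver (λ x → sumOver (allFin n) (q x)) x)

      embeddings : List Dominating
      embeddings = concatMap (λ c → map dominating (stages c Σq)) (codes n)

      sumOver-embeddings : ∀ f → sumOver embeddings f ≡
        sumOver (codes n) (λ c → sumOver (stages c Σq) (f ∘ dominating))
      sumOver-embeddings f = trans (sumOver-concatMap (λ c → map dominating (stages c Σq)) (codes n) f)
        (sumOver-cong (codes n) λ c → sumOver-map dominating (stages c Σq) f)

      sumOver-embeddings-const : ∀ k → sumOver embeddings (λ _ → k) ≡ n ! * (#stages Σq * k)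
      sumOver-embeddings-const k = trans (sumOver-embeddings (λ _ → k))
        (trans (sumOver-cong (codes n) λ c → sumOver-stages-const c Σq k) (sumOver-codes-const n _))

      #stages>0 : ∀ i → 0 < #stages i
      #stages>0 zero    = s≤s z≤n
      #stages>0 (suc i) = *-mono-≤ (m^n>0 2 i) (#stages>0 i)

      embeddings-nonempty : 0 < sumOver embeddings (λ _ → 1)
      embeddings-nonempty = subst (0 <_) (sym (sumOver-embeddings-const 1))
        (*-mono-≤ (1≤n! n) (*-mono-≤ (#stages>0 Σq) ≤-refl))

      -- Stage 0 contributes 4 and the hits contribute 8 H_n, where H_n ≤ 1 + ⌊log₂ n⌋; hence 12 + 8
      -- ⌊log₂ n⌋.
      embeddings-stretch : ∀ u v → sumOver embeddings (λ ω → δ (Dominating.metric ω) u v) ≤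
        sumOver embeddings (λ _ → 1) * ((12 + 8 * ⌊log₂ n ⌋) * q u v)
      embeddings-stretch u v = begin
        sumOver embeddings (λ ω → δ (Dominating.metric ω) u v)
          ≡⟨ sumOver-embeddings (λ ω → δ (Dominating.metric ω) u v) ⟩
        sumOver (codes n) (λ c → sumOver (stages c Σq) (λ s → δ (Stage.um s) u v))
          ≤⟨ sumOver-mono (codes n) (λ c → ≤-trans (Σstages≤ u v c Σq)
               (*-monoʳ-≤ N (+-monoʳ-≤ (4 * q u v) (*-monoʳ-≤ 8 (Σhits≤ u v (2 ^ Σq) id c))))) ⟩
        sumOver (codes n) (λ c → N * (4 * q u v + 8 * (records u v id c * q u v)))
          ≡⟨ sumOver-*ˡ (codes n) N (λ c → 4 * q u v + 8 * (records u v id c * q u v)) ⟩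
        N * sumOver (codes n) (λ c → 4 * q u v + 8 * (records u v id c * q u v))
          ≡⟨ cong (N *_) (trans (sumOver-+ (codes n) (λ _ → 4 * q u v) (λ c → 8 * (records u v id c * q u v)))
               (cong₂ _+_ (sumOver-codes-const n (4 * q u v))
                 (trans (sumOver-*ˡ (codes n) 8 (λ c → records u v id c * q u v))
                   (cong (8 *_) (sumOver-*ʳ (codes n) (records u v id) (q u v)))))) ⟩
        N * (n ! * (4 * q u v) + 8 * (sumOver (codes n) (records u v id) * q u v))
          ≤⟨ *-monoʳ-≤ N (+-monoʳ-≤ (n ! * (4 * q u v)) (*-monoʳ-≤ 8 (*-monoˡ-≤ (q u v)
               (≤-trans (Σrecords≤ u v id) (harmonic≤ n))))) ⟩
        N * (n ! * (4 * q u v) + 8 * (n ! * suc l * q u v))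
          ≡⟨ solve 4 (λ N f q l → N :* (f :* (con 4 :* q) :+ con 8 :* (f :* (con 1 :+ l) :* q))
               := f :* (N :* con 1) :* ((con 12 :+ con 8 :* l) :* q)) refl N (n !) (q u v) l ⟩
        n ! * (N * 1) * ((12 + 8 * l) * q u v)
          ≡⟨ cong (_* ((12 + 8 * l) * q u v)) (sumOver-embeddings-const 1) ⟨
        sumOver embeddings (λ _ → 1) * ((12 + 8 * l) * q u v) ∎
        where
        open ≤-Reasoning
        open +-*-Solver
        N = #stages Σq
        l = ⌊log₂ n ⌋

  -- The taxis on an ultrametric

  module _ {k : ℕ} (x : Fin k → ℕ) where

    above : ℕ → ℕ
    above θ = sumOver (allFin k) (λ j → 𝟙 (θ <? x j))

    above≤k : ∀ θ → above θ ≤ k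
    above≤k θ = ≤-trans (sumOver-mono (allFin k) (λ j → 𝟙≤1 (θ <? x j)))
      (≤-reflexive (trans (sumOver-allFin-const k 1) (*-identityʳ k)))

    -- A weight exceeding the total weight of all taxis strictly further away.
    rank : Fin k → ℕ
    rank j = 2 ^ above (x j)

    rankAbove : ℕ → ℕ
    rankAbove θ = sumOver (allFin k) (λ j → 𝟙 (θ <? x j) * rank j)

    -- Induction downwards on the threshold. The `a` taxis at distance exactly θ + 1 have the common
    -- weight `p`, and those beyond weigh less than `p` together, so the total is below (a + 1) p ≤
    -- 2^a p. A weight shared by equidistant taxis takes the place of a sorted order with ties
    -- broken.
    rankAbove< : ∀ θ → rankAbove θ < 2 ^ above θ
    rankAbove< θ = go (sumOver (allFin k) x) θ λ j → ≤-trans (≤sumOver x j) (m≤n+m _ θ)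
      where
      go : ∀ m θ → (∀ j → x j ≤ θ + m) → rankAbove θ < 2 ^ above θ
      go zero θ x≤ = ≤-trans (s≤s (≤-reflexive (sumOver-≡0 (allFin k) λ j →
        cong (_* rank j) (𝟙-no (θ <? x j) (≤⇒≯ (subst (x j ≤_) (+-identityʳ θ) (x≤ j)))))))
        (m^n>0 2 (above θ))
      go (suc m) θ x≤ = begin-strict
        rankAbove θ                       ≡⟨ trans (sumOver-cong (allFin k) split-rank)
                                               (trans (sumOver-+ (allFin k) _ _) (cong (rankAbove (suc θ) +_) (sumOver-*ʳ (allFin k) _ _))) ⟩
        rankAbove (suc θ) + a * p         <⟨ +-monoˡ-< (a * p) (go m (suc θ) λ j → subst (x j ≤_) (+-suc θ m) (x≤ j)) ⟩
        suc a * p                         ≤⟨ *-monoˡ-≤ p (n<2^n a) ⟩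
        2 ^ a * p                         ≡⟨ ^-distribˡ-+-* 2 a (above (suc θ)) ⟨
        2 ^ (a + above (suc θ))           ≡⟨ cong (2 ^_) (trans (+-comm a _) (sym (trans (sumOver-cong (allFin k) split) (sumOver-+ (allFin k) _ _)))) ⟩
        2 ^ above θ                       ∎
        where
        open ≤-Reasoning
        a = sumOver (allFin k) (λ j → 𝟙 (x j ℕ.≟ suc θ))
        p = 2 ^ above (suc θ)
        split : ∀ j → 𝟙 (θ <? x j) ≡ 𝟙 (suc θ <? x j) + 𝟙 (x j ℕ.≟ suc θ)
        split j = cases (suc θ <? x j) (x j ℕ.≟ suc θ)
          where
          cases : (d : Dec (suc θ < x j)) (e : Dec (x j ≡ suc θ)) → 𝟙 (θ <? x j) ≡ 𝟙 d + 𝟙 e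
          cases (yes lt) (yes eq) = contradiction (sym eq) (<⇒≢ lt)
          cases (yes lt) (no _)   = 𝟙-yes (θ <? x j) (<-trans (n<1+n θ) lt)
          cases (no _)   (yes eq) = 𝟙-yes (θ <? x j) (≤-reflexive (sym eq))
          cases (no ≮)   (no ≢)   = 𝟙-no (θ <? x j) λ lt → ≮ (≤∧≢⇒< lt (≢ ∘ sym))
        split-rank : ∀ j → 𝟙 (θ <? x j) * rank j ≡ 𝟙 (suc θ <? x j) * rank j + 𝟙 (x j ℕ.≟ suc θ) * p
        split-rank j = trans (cong (_* rank j) (split j))
          (trans (*-distribʳ-+ (rank j) (𝟙 (suc θ <? x j)) _) (cong (𝟙 (suc θ <? x j) * rank j +_) (at (x j ℕ.≟ suc θ))))
          where
          at : (e : Dec (x j ≡ suc θ)) → 𝟙 e * rank j ≡ 𝟙 e * p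
          at (yes eq) = cong (λ t → 1 * 2 ^ above t) eq
          at (no _)   = refl

  -- With x the distances to the request and i the taxi matched to the adversary's
  -- serving taxi: the expected cost plus 2^k times the expected increase of the
  -- matching is nonpositive when taxi j serves with probability proportional to W j.
  Balanced : ∀ {k} → (Fin k → ℕ) → (Fin k → ℕ) → Set
  Balanced {k} x W = ∀ i →
    sumOver (allFin k) (λ j → W j * x j) + 2 ^ k * sumOver (allFin k) (λ j → W j * (x j ∸ x i)) ≤ 2 ^ k * (W i * x i)

  -- If a taxi is already at the source, only such taxis serve, and the left side vanishes.
  -- Otherwise the product `P` of all distances serves as common denominator, and `W j * x j` equals
  -- `P * rank x j`. The moves then cost at most P * 2^k, and the excess over `x i` is at most P
  -- times `rankAbove x (x i)`. The latter is below `rank x i` by at least one unit; scaled by 2^k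
  -- P, this unit pays for the moves, which is why the potential carries the factor 2^k.
  balancedWeights : ∀ {k} .{{_ : NonZero k}} (x : Fin k → ℕ) → ∃[ W ] (0 < sumOver (allFin k) W × Balanced x W)
  balancedWeights {k@(suc _)} x with any? (λ j → x j ℕ.≟ 0)
  ... | yes (j₀ , x≡0) = (λ j → 𝟙 (x j ℕ.≟ 0))
                       , ≤-trans (≤-reflexive (sym (𝟙-yes (x j₀ ℕ.≟ 0) x≡0))) (≤sumOver (λ j → 𝟙 (x j ℕ.≟ 0)) j₀)
                       , λ i → ≤-trans (≤-reflexive (zeros i)) z≤n
    where
    vanish : ∀ j y → y ≤ x j → 𝟙 (x j ℕ.≟ 0) * y ≡ 0
    vanish j y y≤ = cases (x j ℕ.≟ 0)
      where
      cases : (d : Dec (x j ≡ 0)) → 𝟙 d * y ≡ 0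
      cases (yes eq) = trans (*-identityˡ y) (n≤0⇒n≡0 (subst (y ≤_) eq y≤))
      cases (no _)   = refl
    zeros : ∀ i → sumOver (allFin k) (λ j → 𝟙 (x j ℕ.≟ 0) * x j) +
                  2 ^ k * sumOver (allFin k) (λ j → 𝟙 (x j ℕ.≟ 0) * (x j ∸ x i)) ≡ 0
    zeros i = cong₂ _+_ (sumOver-≡0 (allFin k) λ j → vanish j (x j) ≤-refl)
      (trans (cong (2 ^ k *_) (sumOver-≡0 (allFin k) λ j → vanish j (x j ∸ x i) (m∸n≤m (x j) (x i))))
        (*-zeroʳ (2 ^ k)))
  ... | no x≢0 = W , ≤-trans (W>0 zero) (≤sumOver W zero) , balanced
    where
    xs = map x (allFin k)
    P  = product xs
    divides : ∀ j → x j ∣ P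
    divides j = ∈⇒∣product (∈-map⁺ x (∈-allFin j))
    instance
      P≢0 : NonZero P
      P≢0 = product≢0 (Allₚ.map⁺ (All.tabulate {xs = allFin k} λ {j} _ → ≢-nonZero λ eq → x≢0 (j , eq)))
    W : Fin k → ℕ
    W j = rank x j * quotient (divides j)
    P≡ : ∀ j → P ≡ quotient (divides j) * x j
    P≡ j = _∣_.equality (divides j)
    W*x : ∀ j → W j * x j ≡ P * rank x j
    W*x j = trans (*-assoc (rank x j) _ (x j)) (trans (cong (rank x j *_) (sym (P≡ j))) (*-comm (rank x j) P))
    W>0 : ∀ j → 0 < W j
    W>0 j = *-mono-≤ (m^n>0 2 (above x (x j))) (n≢0⇒n>0 λ eq →
      ≢-nonZero⁻¹ P (trans (P≡ j) (cong (_* x j) eq)))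
    Σrank≤ : sumOver (allFin k) (rank x) ≤ 2 ^ k
    Σrank≤ = begin
      sumOver (allFin k) (rank x)  ≡⟨ sumOver-cong (allFin k) (λ j → trans (sym (*-identityˡ (rank x j)))
                                        (cong (_* rank x j) (sym (𝟙-yes (0 <? x j) (n≢0⇒n>0 λ eq → x≢0 (j , eq)))))) ⟩
      rankAbove x 0                ≤⟨ <⇒≤ (rankAbove< x 0) ⟩
      2 ^ above x 0                ≤⟨ ^-monoʳ-≤ 2 (above≤k x 0) ⟩
      2 ^ k                        ∎
      where open ≤-Reasoning
    excess : ∀ i j → W j * (x j ∸ x i) ≤ P * (𝟙 (x i <? x j) * rank x j)
    excess i j = cases (x i <? x j)
      where
      cases : (d : Dec (x i < x j)) → W j * (x j ∸ x i) ≤ P * (𝟙 d * rank x j)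
      cases (yes _) = ≤-trans (*-monoʳ-≤ (W j) (m∸n≤m (x j) (x i)))
        (≤-reflexive (trans (W*x j) (cong (P *_) (sym (*-identityˡ (rank x j))))))
      cases (no ≮)  = ≤-trans (≤-reflexive (trans (cong (W j *_) (m≤n⇒m∸n≡0 (≮⇒≥ ≮))) (*-zeroʳ (W j)))) z≤n
    balanced : Balanced x W
    balanced i = begin
      sumOver (allFin k) (λ j → W j * x j) + 2 ^ k * sumOver (allFin k) (λ j → W j * (x j ∸ x i))
        ≤⟨ +-mono-≤
             (≤-reflexive (trans (sumOver-cong (allFin k) W*x) (sumOver-*ˡ (allFin k) P (rank x))))
             (*-monoʳ-≤ (2 ^ k) (≤-trans (sumOver-mono (allFin k) (excess i)) (≤-reflexive (sumOver-*ˡ (allFin k) P _)))) ⟩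
      P * sumOver (allFin k) (rank x) + 2 ^ k * (P * rankAbove x (x i))
        ≤⟨ +-monoˡ-≤ _ (*-monoʳ-≤ P Σrank≤) ⟩
      P * 2 ^ k + 2 ^ k * (P * rankAbove x (x i))
        ≡⟨ solve 3 (λ P t r → P :* t :+ t :* (P :* r) := t :* (P :* (con 1 :+ r))) refl P (2 ^ k) (rankAbove x (x i)) ⟩
      2 ^ k * (P * suc (rankAbove x (x i)))
        ≤⟨ *-monoʳ-≤ (2 ^ k) (*-monoʳ-≤ P (rankAbove< x (x i))) ⟩
      2 ^ k * (P * rank x i)
        ≡⟨ cong (2 ^ k *_) (W*x i) ⟨
      2 ^ k * (W i * x i) ∎
      where
      open ≤-Reasoning
      open +-*-Solver

  -- Matchings between two configurations

  transpose-ˡ : ∀ {k} (i j : Fin k) → transpose i j ⟨$⟩ʳ i ≡ j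
  transpose-ˡ i j rewrite dec-true (i ≟ i) refl = refl

  transpose-ʳ : ∀ {k} (i j : Fin k) → i ≢ j → transpose i j ⟨$⟩ʳ j ≡ i
  transpose-ʳ i j i≢j rewrite dec-false (j ≟ i) (i≢j ∘ sym) | dec-true (j ≟ j) refl = refl

  transpose-off : ∀ {k} (i j l : Fin k) → l ≢ i → l ≢ j → transpose i j ⟨$⟩ʳ l ≡ l
  transpose-off i j l l≢i l≢j rewrite dec-false (l ≟ i) l≢i | dec-false (l ≟ j) l≢j = refl

  movement : ∀ {k n} → (Fin n → Fin n → ℕ) → Vec (Fin n) k → Vec (Fin n) k → ℕ
  movement {k} D C C′ = sumOver (allFin k) (λ l → D (lookup C l) (lookup C′ l))

  module _ {k n : ℕ} (ω : Ultrametric n) where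

    private
      D = δ ω

    matching : Vec (Fin n) k → Vec (Fin n) k → Permutation′ k → ℕ
    matching X Y π = sumOver (allFin k) (λ l → D (lookup X l) (lookup Y (π ⟨$⟩ʳ l)))

    δ-triangle : ∀ x y z → D x z ≤ D x y + D y z
    δ-triangle x y z = ≤-trans (δ-ultra ω x y z) (m⊔n≤m+n (D x y) (D y z))

    matching-move : ∀ X Y Y′ π → matching X Y′ π ≤ matching X Y π + movement D Y Y′
    matching-move X Y Y′ π = begin
      matching X Y′ π
        ≤⟨ sumOver-mono (allFin k) (λ l → δ-triangle (lookup X l) (lookup Y (π ⟨$⟩ʳ l)) _) ⟩
      sumOver (allFin k) (λ l → D (lookup X l) (lookup Y (π ⟨$⟩ʳ l)) + step (π ⟨$⟩ʳ l))
        ≡⟨ sumOver-+ (allFin k) _ _ ⟩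
      matching X Y π + sumOver (allFin k) (step ∘ (π ⟨$⟩ʳ_))
        ≡⟨ cong (matching X Y π +_) (sumOver-permute step π) ⟩
      matching X Y π + movement D Y Y′ ∎
      where
      open ≤-Reasoning
      step : Fin k → ℕ
      step l = D (lookup Y l) (lookup Y′ l)

    -- Let the serving taxi take over the adversary's serving taxi and, if these were
    -- not matched before, match their two former partners with each other.
    rematch : ∀ (X T : Vec (Fin n) k) (i′ : Fin k) s t π j → let i = π ⟨$⟩ˡ i′ in ∃[ π′ ]
      (matching (X [ j ]≔ t) (T [ i′ ]≔ t) π′ + 𝟙 (i ≟ j) * D (lookup X i) s ≤
       matching X (T [ i′ ]≔ s) π + (D (lookup X j) s ∸ D (lookup X i) s))
    rematch X T i′ s t π j with (π ⟨$⟩ˡ i′) ≟ j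
    ... | yes refl = π , (begin
      Σf + (A + 0)        ≡⟨ cong (Σf +_) (+-identityʳ A) ⟩
      Σf + A              ≡⟨ cong (Σf +_) g-i ⟨
      Σf + g i            ≡⟨ sumOver-update f g i off ⟩
      Σg + f i            ≡⟨ cong (Σg +_) f-i ⟩
      Σg + 0              ≤⟨ +-monoʳ-≤ Σg z≤n ⟩
      Σg + (A ∸ A)        ∎)
      where
      open ≤-Reasoning
      i = π ⟨$⟩ˡ i′
      A = D (lookup X i) s
      f g : Fin k → ℕ
      f l = D (lookup (X [ i ]≔ t) l) (lookup (T [ i′ ]≔ t) (π ⟨$⟩ʳ l))
      g l = D (lookup X l) (lookup (T [ i′ ]≔ s) (π ⟨$⟩ʳ l))
      Σf = sumOver (allFin k) f
      Σg = sumOver (allFin k) g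
      g-i : g i ≡ A
      g-i = cong (D (lookup X i)) (trans (cong (lookup (T [ i′ ]≔ s)) (inverseʳ π)) (lookup∘update i′ T s))
      f-i : f i ≡ 0
      f-i = trans (cong₂ D (lookup∘update i X t) (trans (cong (lookup (T [ i′ ]≔ t)) (inverseʳ π)) (lookup∘update i′ T t))) (δ-refl ω t)
      π≢ : ∀ l → l ≢ i → π ⟨$⟩ʳ l ≢ i′
      π≢ l l≢i eq = l≢i (trans (sym (inverseˡ π)) (cong (π ⟨$⟩ˡ_) eq))
      off : ∀ l → l ≢ i → f l ≡ g l
      off l l≢i = cong₂ D (lookup∘update′ l≢i X t)
        (trans (lookup∘update′ (π≢ l l≢i) T t) (sym (lookup∘update′ (π≢ l l≢i) T s)))
    ... | no i≢j = transpose i j ∘ₚ π , +-cancelʳ-≤ (A + B) _ _ (begin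
      Σf + 0 + (A + B)          ≡⟨ cong₂ (λ a b → a + b) (+-identityʳ Σf) (sym (cong₂ _+_ g-i refl)) ⟩
      Σf + (g i + g j)          ≡⟨ sumOver-update₂ f g i j i≢j off ⟩
      Σg + (f i + f j)          ≡⟨ cong (Σg +_) (trans (cong (f i +_) f-j) (+-identityʳ (f i))) ⟩
      Σg + f i                  ≤⟨ +-monoʳ-≤ Σg f-i ⟩
      Σg + (C ∸ A + (A + B))    ≡⟨ +-assoc Σg (C ∸ A) (A + B) ⟨
      Σg + (C ∸ A) + (A + B)    ∎)
      where
      open ≤-Reasoning
      i = π ⟨$⟩ˡ i′
      y = lookup (T [ i′ ]≔ s) (π ⟨$⟩ʳ j)
      A = D (lookup X i) s
      B = D (lookup X j) y
      C = D (lookup X j) s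
      f g : Fin k → ℕ
      f l = D (lookup (X [ j ]≔ t) l) (lookup (T [ i′ ]≔ t) (π ⟨$⟩ʳ (transpose i j ⟨$⟩ʳ l)))
      g l = D (lookup X l) (lookup (T [ i′ ]≔ s) (π ⟨$⟩ʳ l))
      Σf = sumOver (allFin k) f
      Σg = sumOver (allFin k) g
      π≢ : ∀ l → l ≢ i → π ⟨$⟩ʳ l ≢ i′
      π≢ l l≢i eq = l≢i (trans (sym (inverseˡ π)) (cong (π ⟨$⟩ˡ_) eq))
      T-off : ∀ l → l ≢ i → lookup (T [ i′ ]≔ t) (π ⟨$⟩ʳ l) ≡ lookup (T [ i′ ]≔ s) (π ⟨$⟩ʳ l)
      T-off l l≢i = trans (lookup∘update′ (π≢ l l≢i) T t) (sym (lookup∘update′ (π≢ l l≢i) T s))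
      g-i : g i ≡ A
      g-i = cong (D (lookup X i)) (trans (cong (lookup (T [ i′ ]≔ s)) (inverseʳ π)) (lookup∘update i′ T s))
      f-j : f j ≡ 0
      f-j = trans (cong₂ D (lookup∘update j X t)
        (trans (cong (lookup (T [ i′ ]≔ t)) (trans (cong (π ⟨$⟩ʳ_) (transpose-ʳ i j i≢j)) (inverseʳ π))) (lookup∘update i′ T t))) (δ-refl ω t)
      off : ∀ l → l ≢ i → l ≢ j → f l ≡ g l
      off l l≢i l≢j = cong₂ D (lookup∘update′ l≢j X t)
        (trans (cong (λ m → lookup (T [ i′ ]≔ t) (π ⟨$⟩ʳ m)) (transpose-off i j l l≢i l≢j)) (T-off l l≢i))
      -- The former partners are joined through the source and the old position of taxi `j`. The
      -- plain triangle inequality would give only A + C + B, an increase by C in place of C ∸ A.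
      f-i : f i ≤ C ∸ A + (A + B)
      f-i = begin
        f i                          ≡⟨ cong₂ D (lookup∘update′ i≢j X t)
          (trans (cong (λ m → lookup (T [ i′ ]≔ t) (π ⟨$⟩ʳ m)) (transpose-ˡ i j)) (T-off j (i≢j ∘ sym))) ⟩
        D (lookup X i) y             ≤⟨ δ-ultra ω _ s y ⟩
        A ⊔ D s y                    ≤⟨ ⊔-monoʳ-≤ A (δ-ultra ω s (lookup X j) y) ⟩
        A ⊔ (D s (lookup X j) ⊔ B)   ≡⟨ cong (λ c → A ⊔ (c ⊔ B)) (δ-sym ω s (lookup X j)) ⟩
        A ⊔ (C ⊔ B)                  ≤⟨ ⊔-lub (≤-trans (m≤m+n A B) (m≤n+m (A + B) (C ∸ A)))
                                          (⊔-lub (≤-trans (m≤n+m∸n C A) (≤-trans (≤-reflexive (+-comm A (C ∸ A))) (+-monoʳ-≤ (C ∸ A) (m≤m+n A B))))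
                                                 (≤-trans (m≤n+m B A) (m≤n+m (A + B) (C ∸ A)))) ⟩
        C ∸ A + (A + B)              ∎

    movement-single : ∀ (X : Vec (Fin n) k) j s → movement D X (X [ j ]≔ s) ≡ D (lookup X j) s
    movement-single X j s = trans
      (sumOver-single (λ l → D (lookup X l) (lookup (X [ j ]≔ s) l)) j λ l l≢j →
        trans (cong (D (lookup X l)) (lookup∘update′ l≢j X s)) (δ-refl ω (lookup X l)))
      (cong (D (lookup X j)) (lookup∘update j X s))

    matching-refl : ∀ X → matching X X idₚ ≡ 0
    matching-refl X = sumOver-≡0 (allFin k) λ l → δ-refl ω (lookup X l)

    potential-drop : ∀ (X Y T : Vec (Fin n) k) i′ s t π rest W → Balanced (λ j → D (lookup X j) s) W →
      sumOver (allFin k) (λ j → W j * (D (lookup X j) s +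
        2 ^ k * (matching (X [ j ]≔ t) (T [ i′ ]≔ t) (proj₁ (rematch X T i′ s t π j)) + rest))) ≤
      sumOver (allFin k) W * (2 ^ k * (matching X Y π + (movement D Y (T [ i′ ]≔ s) + rest)))
    potential-drop X Y T i′ s t π rest W balanced = +-cancelʳ-≤ (K * (W i * x i)) _ _ (begin
      Σ (λ j → W j * (x j + K * (m′ j + rest))) + K * (W i * x i)
        ≡⟨ cong (_+ K * (W i * x i)) expand ⟩
      Σ (λ j → W j * x j) + K * (Σ (λ j → W j * m′ j) + Σ W * rest) + K * (W i * x i)
        ≡⟨ solve 5 (λ a K b c w → a :+ K :* (b :+ c) :+ K :* w := a :+ K :* c :+ K :* (b :+ w)) refl
             (Σ (λ j → W j * x j)) K (Σ (λ j → W j * m′ j)) (Σ W * rest) (W i * x i) ⟩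
      Σ (λ j → W j * x j) + K * (Σ W * rest) + K * (Σ (λ j → W j * m′ j) + W i * x i)
        ≤⟨ +-monoʳ-≤ (Σ (λ j → W j * x j) + K * (Σ W * rest)) (*-monoʳ-≤ K matchings) ⟩
      Σ (λ j → W j * x j) + K * (Σ W * rest) + K * (Σ W * m + Σ (λ j → W j * (x j ∸ x i)))
        ≡⟨ solve 6 (λ a K N r m e → a :+ K :* (N :* r) :+ K :* (N :* m :+ e) := N :* (K :* (m :+ r)) :+ (a :+ K :* e)) refl
             (Σ (λ j → W j * x j)) K (Σ W) rest m (Σ (λ j → W j * (x j ∸ x i))) ⟩
      Σ W * (K * (m + rest)) + (Σ (λ j → W j * x j) + K * Σ (λ j → W j * (x j ∸ x i)))
        ≤⟨ +-mono-≤ (*-monoʳ-≤ (Σ W) (*-monoʳ-≤ K (≤-trans (+-monoˡ-≤ rest (matching-move X Y (T [ i′ ]≔ s) π))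
             (≤-reflexive (+-assoc (matching X Y π) _ rest))))) (balanced i) ⟩
      Σ W * (K * (matching X Y π + (movement D Y (T [ i′ ]≔ s) + rest))) + K * (W i * x i) ∎)
      where
      open ≤-Reasoning
      open +-*-Solver
      Σ = sumOver (allFin k)
      K = 2 ^ k
      i = π ⟨$⟩ˡ i′
      m = matching X (T [ i′ ]≔ s) π
      x m′ : Fin k → ℕ
      x j  = D (lookup X j) s
      m′ j = matching (X [ j ]≔ t) (T [ i′ ]≔ t) (proj₁ (rematch X T i′ s t π j))
      expand : Σ (λ j → W j * (x j + K * (m′ j + rest))) ≡
               Σ (λ j → W j * x j) + K * (Σ (λ j → W j * m′ j) + Σ W * rest)
      expand = trans (sumOver-cong (allFin k) λ j →
          solve 5 (λ w x K m r → w :* (x :+ K :* (m :+ r)) := w :* x :+ K :* (w :* m :+ w :* r)) refl (W j) (x j) K (m′ j) rest)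
        (trans (sumOver-+ (allFin k) _ _) (cong (Σ (λ j → W j * x j) +_)
          (trans (sumOver-*ˡ (allFin k) K _) (cong (K *_)
            (trans (sumOver-+ (allFin k) _ _) (cong (Σ (λ j → W j * m′ j) +_) (sumOver-*ʳ (allFin k) W rest)))))))
      at-i : Σ (λ j → W j * (𝟙 (i ≟ j) * x i)) ≡ W i * x i
      at-i = trans
        (sumOver-single (λ j → W j * (𝟙 (i ≟ j) * x i)) i λ j j≢i →
          trans (cong (λ e → W j * (e * x i)) (𝟙-no (i ≟ j) (j≢i ∘ sym))) (*-zeroʳ (W j)))
        (cong (W i *_) (trans (cong (_* x i) (𝟙-yes (i ≟ i) refl)) (*-identityˡ (x i))))
      matchings : Σ (λ j → W j * m′ j) + W i * x i ≤ Σ W * m + Σ (λ j → W j * (x j ∸ x i))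
      matchings = begin
        Σ (λ j → W j * m′ j) + W i * x i
          ≡⟨ trans (cong (Σ (λ j → W j * m′ j) +_) (sym at-i)) (sym (trans
               (sumOver-cong (allFin k) λ j → *-distribˡ-+ (W j) (m′ j) _) (sumOver-+ (allFin k) _ _))) ⟩
        Σ (λ j → W j * (m′ j + 𝟙 (i ≟ j) * x i))
          ≤⟨ sumOver-mono (allFin k) (λ j → *-monoʳ-≤ (W j) (proj₂ (rematch X T i′ s t π j))) ⟩
        Σ (λ j → W j * (m + (x j ∸ x i)))
          ≡⟨ trans (sumOver-cong (allFin k) λ j → *-distribˡ-+ (W j) m _)
               (trans (sumOver-+ (allFin k) _ _) (cong (_+ Σ (λ j → W j * (x j ∸ x i))) (sumOver-*ʳ (allFin k) W m))) ⟩
        Σ W * m + Σ (λ j → W j * (x j ∸ x i)) ∎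

open Combinatorics
open import Defs
open import Data.Integer using (+_; +[1+_])
import Data.Integer as ℤ
import Data.Integer.Properties as ℤₚ
open import Data.Rational using (ℚ; mkℚ; 0ℚ; 1ℚ; ½)
import Data.Rational as ℚ
import Data.Rational.Properties as ℚₚ
open import Data.Rational.Solver using (module +-*-Solver)
open import Data.Rational.Unnormalised using (mkℚᵘ)
import Data.Rational.Unnormalised as ℚᵘ
import Data.Rational.Unnormalised.Properties as ℚᵘₚ

-- Real numbers

ι : ℕ → ℚ
ι m = (+ m) ℚ./ 1

toℚᵘ-ι : ∀ m → ℚ.toℚᵘ (ι m) ℚᵘ.≃ mkℚᵘ (+ m) 0
toℚᵘ-ι m = ℚₚ.toℚᵘ-fromℚᵘ (mkℚᵘ (+ m) 0)

ι-+ : ∀ m n → ι (m ℕ.+ n) ≡ ι m ℚ.+ ι n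
ι-+ m n = ℚₚ.toℚᵘ-injective (begin-equality
  ℚ.toℚᵘ (ι (m ℕ.+ n))               ≃⟨ toℚᵘ-ι (m ℕ.+ n) ⟩
  mkℚᵘ (+ (m ℕ.+ n)) 0               ≃⟨ ℚᵘ.*≡* (cong (ℤ._* + 1) (trans (ℤₚ.pos-+ m n)
                                          (sym (cong₂ ℤ._+_ (ℤₚ.*-identityʳ (+ m)) (ℤₚ.*-identityʳ (+ n)))))) ⟩
  mkℚᵘ (+ m) 0 ℚᵘ.+ mkℚᵘ (+ n) 0     ≃⟨ ℚᵘₚ.+-cong (toℚᵘ-ι m) (toℚᵘ-ι n) ⟨
  ℚ.toℚᵘ (ι m) ℚᵘ.+ ℚ.toℚᵘ (ι n)     ≃⟨ ℚₚ.toℚᵘ-homo-+ (ι m) (ι n) ⟨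
  ℚ.toℚᵘ (ι m ℚ.+ ι n)               ∎)
  where open ℚᵘₚ.≤-Reasoning

ι-* : ∀ m n → ι (m ℕ.* n) ≡ ι m ℚ.* ι n
ι-* m n = ℚₚ.toℚᵘ-injective (begin-equality
  ℚ.toℚᵘ (ι (m ℕ.* n))               ≃⟨ toℚᵘ-ι (m ℕ.* n) ⟩
  mkℚᵘ (+ (m ℕ.* n)) 0               ≃⟨ ℚᵘ.*≡* (cong (ℤ._* + 1) (ℤₚ.pos-* m n)) ⟩
  mkℚᵘ (+ m) 0 ℚᵘ.* mkℚᵘ (+ n) 0     ≃⟨ ℚᵘₚ.*-cong (toℚᵘ-ι m) (toℚᵘ-ι n) ⟨
  ℚ.toℚᵘ (ι m) ℚᵘ.* ℚ.toℚᵘ (ι n)     ≃⟨ ℚₚ.toℚᵘ-homo-* (ι m) (ι n) ⟨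
  ℚ.toℚᵘ (ι m ℚ.* ι n)               ∎)
  where open ℚᵘₚ.≤-Reasoning

ι-mono : ∀ {m n} → m ℕ.≤ n → ι m ℚ.≤ ι n
ι-mono {m} {n} m≤n = ℚₚ.toℚᵘ-cancel-≤ (begin
  ℚ.toℚᵘ (ι m)   ≃⟨ toℚᵘ-ι m ⟩
  mkℚᵘ (+ m) 0   ≤⟨ ℚᵘ.*≤* (ℤₚ.*-monoʳ-≤-nonNeg (+ 1) (ℤ.+≤+ m≤n)) ⟩
  mkℚᵘ (+ n) 0   ≃⟨ toℚᵘ-ι n ⟨
  ℚ.toℚᵘ (ι n)   ∎)
  where open ℚᵘₚ.≤-Reasoning

0≤ι : ∀ m → 0ℚ ℚ.≤ ι m
0≤ι m = ι-mono {0} {m} ℕ.z≤n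

ι-mono-< : ∀ {m n} → m ℕ.< n → ι m ℚ.< ι n
ι-mono-< {m} {n} m<n = ℚₚ.<-≤-trans
  (subst₂ ℚ._<_ (ℚₚ.+-identityˡ (ι m)) (sym (ι-+ 1 m)) (ℚₚ.+-monoˡ-< (ι m) (ℚₚ.positive⁻¹ (ι 1))))
  (ι-mono m<n)

ι-cancel-≤ : ∀ {m n} → ι m ℚ.≤ ι n → m ℕ.≤ n
ι-cancel-≤ {m} {n} h with m ℕ.≤? n
... | yes m≤n = m≤n
... | no m≰n  = contradiction (ℚₚ.<-≤-trans (ι-mono-< (ℕₚ.≰⇒> m≰n)) h) (ℚₚ.<-irrefl refl)

≤-pointwise : ∀ {x y} → (∀ m → seq x m ℚ.≤ seq y m) → x ≤ y
≤-pointwise {x} {y} h ε 0<ε = 0 , λ m _ → ℚₚ.≤-trans (h m)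
  (subst (ℚ._≤ seq y m ℚ.+ ε) (ℚₚ.+-identityʳ (seq y m)) (ℚₚ.+-monoʳ-≤ (seq y m) (ℚₚ.<⇒≤ 0<ε)))

≤-eventually : ∀ {x y} → ∃[ N ] (∀ m → N ℕ.≤ m → seq x m ℚ.≤ seq y m) → x ≤ y
≤-eventually {x} {y} (N , h) ε 0<ε = N , λ m N≤m → ℚₚ.≤-trans (h m N≤m)
  (subst (ℚ._≤ seq y m ℚ.+ ε) (ℚₚ.+-identityʳ (seq y m)) (ℚₚ.+-monoʳ-≤ (seq y m) (ℚₚ.<⇒≤ 0<ε)))

½+½ : ∀ ε → ½ ℚ.* ε ℚ.+ ½ ℚ.* ε ≡ ε
½+½ = solve 1 (λ e → con ½ :* e :+ con ½ :* e := e) refl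
  where open +-*-Solver

≤-trans : ∀ {x y z} → x ≤ y → y ≤ z → x ≤ z
≤-trans {x} {y} {z} x≤y y≤z ε 0<ε =
  let N₁ , h₁ = x≤y (½ ℚ.* ε) (0<½*p 0<ε)
      N₂ , h₂ = y≤z (½ ℚ.* ε) (0<½*p 0<ε)
  in N₁ ℕ.⊔ N₂ , λ m N≤m → begin
    seq x m                                ≤⟨ h₁ m (ℕₚ.m⊔n≤o⇒m≤o N₁ N₂ N≤m) ⟩
    seq y m ℚ.+ ½ ℚ.* ε                    ≤⟨ ℚₚ.+-monoˡ-≤ (½ ℚ.* ε) (h₂ m (ℕₚ.m⊔n≤o⇒n≤o N₁ N₂ N≤m)) ⟩
    seq z m ℚ.+ ½ ℚ.* ε ℚ.+ ½ ℚ.* ε        ≡⟨ trans (ℚₚ.+-assoc (seq z m) _ _) (cong (seq z m ℚ.+_) (½+½ ε)) ⟩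
    seq z m ℚ.+ ε                          ∎
  where open ℚₚ.≤-Reasoning

≈⇒≤ : ∀ {x y} → x ≈ y → x ≤ y
≈⇒≤ x≈y ε 0<ε = let N , h = x≈y ε 0<ε in N , λ m N≤m → ∣p-q∣≤e⇒p≤q+e (h m N≤m)

≈-sym : ∀ {x y} → x ≈ y → y ≈ x
≈-sym {x} {y} x≈y ε 0<ε = let N , h = x≈y ε 0<ε in N , λ m N≤m →
  subst (ℚ._≤ ε) (trans (sym (ℚₚ.∣-p∣≡∣p∣ (seq x m ℚ.- seq y m)))
    (cong ℚ.∣_∣ (solve 2 (λ p q → :- (p :- q) := q :- p) refl (seq x m) (seq y m)))) (h m N≤m)
  where open +-*-Solver

+-mono-≤ : ∀ {x y z w} → x ≤ y → z ≤ w → x + z ≤ y + w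
+-mono-≤ {x} {y} {z} {w} x≤y z≤w ε 0<ε =
  let N₁ , h₁ = x≤y (½ ℚ.* ε) (0<½*p 0<ε)
      N₂ , h₂ = z≤w (½ ℚ.* ε) (0<½*p 0<ε)
  in N₁ ℕ.⊔ N₂ , λ m N≤m → begin
    seq x m ℚ.+ seq z m
      ≤⟨ ℚₚ.+-mono-≤ (h₁ m (ℕₚ.m⊔n≤o⇒m≤o N₁ N₂ N≤m)) (h₂ m (ℕₚ.m⊔n≤o⇒n≤o N₁ N₂ N≤m)) ⟩
    (seq y m ℚ.+ ½ ℚ.* ε) ℚ.+ (seq w m ℚ.+ ½ ℚ.* ε)
      ≡⟨ solve 3 (λ y w e → (y :+ con ½ :* e) :+ (w :+ con ½ :* e) := (y :+ w) :+ e) refl (seq y m) (seq w m) ε ⟩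
    (seq y m ℚ.+ seq w m) ℚ.+ ε ∎
  where
  open ℚₚ.≤-Reasoning
  open +-*-Solver

scale-ε : ∀ {B ε} → 0ℚ ℚ.< B → 0ℚ ℚ.< ε → ∃[ δ ] (0ℚ ℚ.< δ × B ℚ.* δ ℚ.≤ ε)
scale-ε {B} {ε} 0<B 0<ε =
  let δ , 0<δ , eq = split-ε {B} {B} 0<B 0<B 0<ε
  in δ , 0<δ , subst (B ℚ.* δ ℚ.≤_) eq
       (subst (ℚ._≤ B ℚ.* δ ℚ.+ B ℚ.* δ) (ℚₚ.+-identityʳ (B ℚ.* δ)) (ℚₚ.+-monoʳ-≤ (B ℚ.* δ)
         (subst (ℚ._≤ B ℚ.* δ) (ℚₚ.*-zeroʳ B) (ℚₚ.*-monoˡ-≤-nonNeg B {{ℚ.nonNegative (ℚₚ.<⇒≤ 0<B)}} (ℚₚ.<⇒≤ 0<δ)))))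

module _ {r y : ℚ} {ρ x : ℝ} (0≤r : 0ℚ ℚ.≤ r) (0≤y : 0ℚ ℚ.≤ y) where

  -- The comparison of y with x holds only up to a small error, which the product multiplies by ρ;
  -- since ρ is eventually bounded, the error can be chosen in advance.
  fromℚ-*-≤ : (∀ m → r ℚ.≤ seq ρ m) → fromℚ y ≤ x → fromℚ (r ℚ.* y) ≤ ρ * x
  fromℚ-*-≤ r≤ρ y≤x ε 0<ε =
    let B , 0<B , N₁ , bound = eventually-bounded (cauchy ρ)
        δ , 0<δ , Bδ≤ε = scale-ε 0<B 0<ε
        N₂ , h = y≤x δ 0<δ
    in N₁ ℕ.⊔ N₂ , λ m N≤m →
      let ρₘ≥0 = ℚ.nonNegative (ℚₚ.≤-trans 0≤r (r≤ρ m)) in begin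
      r ℚ.* y                                    ≤⟨ ℚₚ.*-monoʳ-≤-nonNeg y {{ℚ.nonNegative 0≤y}} (r≤ρ m) ⟩
      seq ρ m ℚ.* y                              ≤⟨ ℚₚ.*-monoˡ-≤-nonNeg (seq ρ m) {{ρₘ≥0}} (h m (ℕₚ.m⊔n≤o⇒n≤o N₁ N₂ N≤m)) ⟩
      seq ρ m ℚ.* (seq x m ℚ.+ δ)                ≡⟨ ℚₚ.*-distribˡ-+ (seq ρ m) (seq x m) δ ⟩
      seq ρ m ℚ.* seq x m ℚ.+ seq ρ m ℚ.* δ      ≤⟨ ℚₚ.+-monoʳ-≤ (seq ρ m ℚ.* seq x m) (ℚₚ.≤-trans
                                                      (ℚₚ.*-monoʳ-≤-nonNeg δ {{ℚ.nonNegative (ℚₚ.<⇒≤ 0<δ)}}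
                                                        (ℚₚ.≤-trans (p≤∣p∣ (seq ρ m)) (bound m (ℕₚ.m⊔n≤o⇒m≤o N₁ N₂ N≤m)))) Bδ≤ε) ⟩
      seq ρ m ℚ.* seq x m ℚ.+ ε                  ∎
    where open ℚₚ.≤-Reasoning

fromℚ-scale-≤ : ∀ {c y x} → 0ℚ ℚ.≤ c → x ≤ fromℚ y → fromℚ c * x ≤ fromℚ (c ℚ.* y)
fromℚ-scale-≤ {c} {y} {x} 0≤c x≤y ε 0<ε =
  -- The factor c may be 0, whereas `split-ε` takes positive factors; hence c + 1.
  let δ , 0<δ , eq = split-ε {c ℚ.+ 1ℚ} {1ℚ} {ε} (ℚₚ.+-mono-≤-< 0≤c (ℚₚ.positive⁻¹ 1ℚ)) (ℚₚ.positive⁻¹ 1ℚ) 0<ε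
      N , h = x≤y δ 0<δ
      0≤δ = ℚₚ.<⇒≤ 0<δ
  in N , λ m N≤m → begin
    c ℚ.* seq x m                ≤⟨ ℚₚ.*-monoˡ-≤-nonNeg c {{ℚ.nonNegative 0≤c}} (h m N≤m) ⟩
    c ℚ.* (y ℚ.+ δ)              ≡⟨ solve 3 (λ c y d → c :* (y :+ d) := c :* y :+ c :* d :+ con 0ℚ) refl c y δ ⟩
    c ℚ.* y ℚ.+ c ℚ.* δ ℚ.+ 0ℚ   ≤⟨ ℚₚ.+-monoʳ-≤ (c ℚ.* y ℚ.+ c ℚ.* δ) (ℚₚ.+-mono-≤ 0≤δ 0≤δ) ⟩
    c ℚ.* y ℚ.+ c ℚ.* δ ℚ.+ (δ ℚ.+ δ)
      ≡⟨ solve 3 (λ c y d → c :* y :+ c :* d :+ (d :+ d) := c :* y :+ ((c :+ con 1ℚ) :* d :+ con 1ℚ :* d)) refl c y δ ⟩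
    c ℚ.* y ℚ.+ ((c ℚ.+ 1ℚ) ℚ.* δ ℚ.+ 1ℚ ℚ.* δ)   ≡⟨ cong (c ℚ.* y ℚ.+_) eq ⟩
    c ℚ.* y ℚ.+ ε                ∎
  where
  open ℚₚ.≤-Reasoning
  open +-*-Solver

-- Which of two reals is smaller is undecidable, but at each index the minimum of the two rational
-- terms is one of them.
≤-*-⊓ : ∀ {x ρ a b} → x ≤ ρ * a → x ≤ ρ * b → x ≤ ρ * (a ⊓ b)
≤-*-⊓ {x} {ρ} {a} {b} x≤ρa x≤ρb ε 0<ε =
  let N₁ , h₁ = x≤ρa ε 0<ε
      N₂ , h₂ = x≤ρb ε 0<ε
  in N₁ ℕ.⊔ N₂ , λ m N≤m → cases m (h₁ m (ℕₚ.m⊔n≤o⇒m≤o N₁ N₂ N≤m)) (h₂ m (ℕₚ.m⊔n≤o⇒n≤o N₁ N₂ N≤m))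
  where
  cases : ∀ m → seq x m ℚ.≤ seq ρ m ℚ.* seq a m ℚ.+ ε → seq x m ℚ.≤ seq ρ m ℚ.* seq b m ℚ.+ ε →
    seq x m ℚ.≤ seq ρ m ℚ.* (seq a m ℚ.⊓ seq b m) ℚ.+ ε
  cases m ha hb with ℚₚ.⊓-sel (seq a m) (seq b m)
  ... | inj₁ eq = subst (λ t → seq x m ℚ.≤ seq ρ m ℚ.* t ℚ.+ ε) (sym eq) ha
  ... | inj₂ eq = subst (λ t → seq x m ℚ.≤ seq ρ m ℚ.* t ℚ.+ ε) (sym eq) hb

≤-*-foldr-⊓ : ∀ {I : Set} {x ρ} (cost : I → ℝ) a is → x ≤ ρ * a → (∀ i → x ≤ ρ * cost i) →
  x ≤ ρ * foldr _⊓_ a (map cost is)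
≤-*-foldr-⊓ cost a []       x≤ρa _ = x≤ρa
≤-*-foldr-⊓ {x = x} {ρ} cost a (i ∷ is) x≤ρa h = ≤-*-⊓ {x} {ρ} {cost i} {foldr _⊓_ a (map cost is)} (h i)
  (≤-*-foldr-⊓ {x = x} {ρ} cost a is x≤ρa h)

-- From 2^l ≤ n follows 2^(l (m+1)) ≤ n^(m+1). The bound holds at every index, the form in which
-- `fromℚ-*-≤` takes its first factor.
⌊log₂⌋≤log₂ : ∀ n .{{_ : NonZero n}} m → ι ⌊log₂ n ⌋ ℚ.≤ seq (log₂ n) m
⌊log₂⌋≤log₂ n m = ℚₚ.toℚᵘ-cancel-≤ (begin
  ℚ.toℚᵘ (ι l)                  ≃⟨ toℚᵘ-ι l ⟩
  mkℚᵘ (+ l) 0                  ≤⟨ ℚᵘ.*≤* (subst₂ ℤ._≤_ (ℤₚ.pos-* l (suc m)) (ℤₚ.pos-* L 1)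
                                     (ℤ.+≤+ (ℕₚ.≤-trans l*m≤L (ℕₚ.≤-reflexive (sym (ℕₚ.*-identityʳ L)))))) ⟩
  mkℚᵘ (+ L) m                  ≃⟨ ℚₚ.toℚᵘ-fromℚᵘ (mkℚᵘ (+ L) m) ⟨
  ℚ.toℚᵘ ((+ L) ℚ./ suc m)      ∎)
  where
  open ℚᵘₚ.≤-Reasoning
  l = ⌊log₂ n ⌋
  L = ⌊log₂ (n ℕ.^ suc m) ⌋
  l*m≤L : l ℕ.* suc m ℕ.≤ L
  l*m≤L = subst (ℕ._≤ L) (⌊log₂[2^n]⌋≡n (l ℕ.* suc m)) (⌊log₂⌋-mono-≤
    (subst (ℕ._≤ n ℕ.^ suc m) (ℕₚ.^-*-assoc 2 l (suc m)) (ℕₚ.^-monoˡ-≤ (suc m) (2^⌊log₂n⌋≤n n))))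

-- Finite distributions given by integer weights

module _ {A I : Set} (value : I → A) (is : List I) (w : I → ℕ) (w>0 : 0 ℕ.< sumOver is w) where

  private
    N = sumOver is w
    instance
      N-pos : ℚ.Positive (ι N)
      N-pos = ℚ.positive (ι-mono-< w>0)
      N≢0 : ℚ.NonZero (ι N)
      N≢0 = ℚₚ.pos⇒nonZero (ι N)

    1/N : ℚ
    1/N = ℚ.1/ (ι N)

    1/N≥0 : 0ℚ ℚ.≤ 1/N
    1/N≥0 = ℚₚ.<⇒≤ (ℚₚ.positive⁻¹ 1/N {{ℚₚ.1/pos⇒pos (ι N)}})

    p : I → ℚ
    p i = ι (w i) ℚ.* 1/N

    p≥0 : ∀ i → 0ℚ ℚ.≤ p i
    p≥0 i = subst (ℚ._≤ p i) (ℚₚ.*-zeroˡ 1/N) (ℚₚ.*-monoʳ-≤-nonNeg 1/N {{ℚ.nonNegative 1/N≥0}} (0≤ι (w i)))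

    outcomes : List I → List (A × ℝ)
    outcomes = map (λ i → value i , fromℚ (p i))

    outcomes-nonNeg : ∀ is → All (λ (_ , p) → 0ℝ ≤ p) (outcomes is)
    outcomes-nonNeg []       = []
    outcomes-nonNeg (i ∷ is) = ≤-pointwise {0ℝ} {fromℚ (p i)} (λ _ → p≥0 i) ∷ outcomes-nonNeg is

    outcomes-total : ∀ is m → seq (∑ (map proj₂ (outcomes is))) m ≡ ι (sumOver is w) ℚ.* 1/N
    outcomes-total []       m = sym (ℚₚ.*-zeroˡ 1/N)
    outcomes-total (i ∷ is) m = trans (cong (p i ℚ.+_) (outcomes-total is m))
      (trans (sym (ℚₚ.*-distribʳ-+ 1/N (ι (w i)) (ι (sumOver is w)))) (cong (ℚ._* 1/N) (sym (ι-+ (w i) (sumOver is w)))))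

  pick : Dist A
  pick = record
    { support = outcomes is
    ; nonNeg  = outcomes-nonNeg is
    ; total   = λ ε 0<ε → 0 , λ m _ → subst (ℚ._≤ ε)
        (sym (trans (cong (λ t → ℚ.∣ t ℚ.- 1ℚ ∣) (trans (outcomes-total is m) (ℚₚ.*-inverseʳ (ι N))))
          (cong ℚ.∣_∣ (ℚₚ.+-inverseʳ 1ℚ)))) (ℚₚ.<⇒≤ 0<ε)
    }

  module _ {γ : ℚ} (0≤γ : 0ℚ ℚ.≤ γ) (f : A → ℝ) (g : I → ℕ) (f≤g : ∀ i → f (value i) ≤ fromℚ (γ ℚ.* ι (g i))) where

    private
      outcomes-≤ : ∀ is → ∑ (map (λ (a , p) → p * f a) (outcomes is)) ≤
        fromℚ (1/N ℚ.* (γ ℚ.* ι (sumOver is (λ i → w i ℕ.* g i))))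
      outcomes-≤ [] = ≤-pointwise {0ℝ} {fromℚ (1/N ℚ.* (γ ℚ.* 0ℚ))}
        (λ _ → ℚₚ.≤-reflexive (sym (trans (cong (1/N ℚ.*_) (ℚₚ.*-zeroʳ γ)) (ℚₚ.*-zeroʳ 1/N))))
      outcomes-≤ (i ∷ is) = ≤-trans {∑ (map (λ (a , p) → p * f a) (outcomes (i ∷ is)))}
        {fromℚ (p i ℚ.* (γ ℚ.* ι (g i))) + fromℚ (1/N ℚ.* (γ ℚ.* ι S))}
        {fromℚ (1/N ℚ.* (γ ℚ.* ι (w i ℕ.* g i ℕ.+ S)))}
        (+-mono-≤ {fromℚ (p i) * f (value i)} {fromℚ (p i ℚ.* (γ ℚ.* ι (g i)))}
          {∑ (map (λ (a , p) → p * f a) (outcomes is))} {fromℚ (1/N ℚ.* (γ ℚ.* ι S))}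
          (fromℚ-scale-≤ {p i} {γ ℚ.* ι (g i)} {f (value i)} (p≥0 i) (f≤g i)) (outcomes-≤ is))
        (≤-pointwise {fromℚ (p i ℚ.* (γ ℚ.* ι (g i))) + fromℚ (1/N ℚ.* (γ ℚ.* ι S))}
          {fromℚ (1/N ℚ.* (γ ℚ.* ι (w i ℕ.* g i ℕ.+ S)))} λ _ → ℚₚ.≤-reflexive (begin
          ι (w i) ℚ.* 1/N ℚ.* (γ ℚ.* ι (g i)) ℚ.+ 1/N ℚ.* (γ ℚ.* ι S)
            ≡⟨ solve 5 (λ w N c g s → w :* N :* (c :* g) :+ N :* (c :* s) := N :* (c :* (w :* g :+ s)))
                 refl (ι (w i)) 1/N γ (ι (g i)) (ι S) ⟩
          1/N ℚ.* (γ ℚ.* (ι (w i) ℚ.* ι (g i) ℚ.+ ι S))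
            ≡⟨ cong (λ t → 1/N ℚ.* (γ ℚ.* t)) (trans (cong (ℚ._+ ι S) (sym (ι-* (w i) (g i)))) (sym (ι-+ (w i ℕ.* g i) S))) ⟩
          1/N ℚ.* (γ ℚ.* ι (w i ℕ.* g i ℕ.+ S)) ∎))
        where
        open ≡-Reasoning
        open +-*-Solver
        S = sumOver is (λ i → w i ℕ.* g i)

    -- The bridge from the counting inequalities over ℕ to expectations: the total weight on the
    -- right cancels against the normalisation.
    𝔼-pick-≤ : ∀ {G} → sumOver is (λ i → w i ℕ.* g i) ℕ.≤ sumOver is w ℕ.* G → 𝔼 pick f ≤ fromℚ (γ ℚ.* ι G)
    𝔼-pick-≤ {G} h = ≤-trans {𝔼 pick f} {fromℚ (1/N ℚ.* (γ ℚ.* ι S))} {fromℚ (γ ℚ.* ι G)} (outcomes-≤ is)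
      (≤-pointwise {fromℚ (1/N ℚ.* (γ ℚ.* ι S))} {fromℚ (γ ℚ.* ι G)} λ _ → begin
        1/N ℚ.* (γ ℚ.* ι S)
          ≤⟨ ℚₚ.*-monoˡ-≤-nonNeg 1/N {{ℚ.nonNegative 1/N≥0}} (ℚₚ.*-monoˡ-≤-nonNeg γ {{ℚ.nonNegative 0≤γ}} (ι-mono h)) ⟩
        1/N ℚ.* (γ ℚ.* ι (N ℕ.* G))
          ≡⟨ cong (λ t → 1/N ℚ.* (γ ℚ.* t)) (ι-* N G) ⟩
        1/N ℚ.* (γ ℚ.* (ι N ℚ.* ι G))
          ≡⟨ solve 4 (λ i c n g → i :* (c :* (n :* g)) := (i :* n) :* (c :* g)) refl 1/N γ (ι N) (ι G) ⟩
        (1/N ℚ.* ι N) ℚ.* (γ ℚ.* ι G)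
          ≡⟨ trans (cong (ℚ._* (γ ℚ.* ι G)) (ℚₚ.*-inverseˡ (ι N))) (ℚₚ.*-identityˡ (γ ℚ.* ι G)) ⟩
        γ ℚ.* ι G ∎)
      where
      open ℚₚ.≤-Reasoning
      open +-*-Solver
      S = sumOver is (λ i → w i ℕ.* g i)

-- Rounding a metric

Eventually : (ℕ → Set) → Set
Eventually P = ∃[ N ] (∀ m → N ℕ.≤ m → P m)

eventually-∀ : ∀ {n} {P : Fin n → ℕ → Set} → (∀ i → Eventually (P i)) → Eventually (λ m → ∀ i → P i m)
eventually-∀ {n} h = sumOver (allFin n) (proj₁ ∘ h) , λ m N≤m i →
  proj₂ (h i) m (ℕₚ.≤-trans (≤sumOver (proj₁ ∘ h) i) N≤m)

eventually-× : ∀ {P Q : ℕ → Set} → Eventually P → Eventually Q → Eventually (λ m → P m × Q m)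
eventually-× (N₁ , h₁) (N₂ , h₂) = N₁ ℕ.⊔ N₂ , λ m N≤m →
  h₁ m (ℕₚ.m⊔n≤o⇒m≤o N₁ N₂ N≤m) , h₂ m (ℕₚ.m⊔n≤o⇒n≤o N₁ N₂ N≤m)

lower-bound : ∀ {n} (e : Fin n → ℚ) → (∀ i → 0ℚ ℚ.< e i) → ∃[ ε ] (0ℚ ℚ.< ε × ∀ i → ε ℚ.≤ e i)
lower-bound {zero}  e e>0 = 1ℚ , ℚₚ.positive⁻¹ 1ℚ , λ ()
lower-bound {suc n} e e>0 with lower-bound (e ∘ suc) (e>0 ∘ suc)
... | ε , ε>0 , ε≤ = e zero ℚ.⊓ ε , positive , λ where
    zero    → ℚₚ.p⊓q≤p (e zero) ε
    (suc i) → ℚₚ.≤-trans (ℚₚ.p⊓q≤q (e zero) ε) (ε≤ i)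
  where
  positive : 0ℚ ℚ.< e zero ℚ.⊓ ε
  positive with ℚₚ.⊓-sel (e zero) ε
  ... | inj₁ eq = subst (0ℚ ℚ.<_) (sym eq) (e>0 zero)
  ... | inj₂ eq = subst (0ℚ ℚ.<_) (sym eq) ε>0

archimedean : ∀ p τ → 0ℚ ℚ.< τ → ∃[ m ] p ℚ.≤ ι m ℚ.* τ
archimedean p@(mkℚ ℤ.-[1+ _ ] _ _) τ _ = 0 , ℚₚ.≤-trans (ℚₚ.<⇒≤ (ℚₚ.negative⁻¹ p)) (ℚₚ.≤-reflexive (sym (ℚₚ.*-zeroˡ τ)))
archimedean (mkℚ (+ a) d c) (mkℚ (+ 0) d′ c′) (ℚ.*<* (ℤ.+<+ ()))
archimedean (mkℚ (+ a) d c) (mkℚ ℤ.-[1+ b ] d′ c′) (ℚ.*<* ())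
-- The numerator a is at least p, and τ times its own denominator is the integer b + 1 ≥ 1.
archimedean p@(mkℚ (+ a) d c) τ@(mkℚ +[1+ b ] d′ c′) _ = a ℕ.* suc d′ , ℚₚ.toℚᵘ-cancel-≤ (begin
  mkℚᵘ (+ a) d                                  ≤⟨ ℚᵘ.*≤* (subst₂ ℤ._≤_ (ℤₚ.pos-* a _) (ℤₚ.pos-* (a ℕ.* suc d′ ℕ.* suc b) (suc d)) (ℤ.+≤+ numerators)) ⟩
  mkℚᵘ (+ (a ℕ.* suc d′ ℕ.* suc b)) d′          ≃⟨ ℚᵘ.*≡* (cong₂ ℤ._*_ (ℤₚ.pos-* (a ℕ.* suc d′) (suc b)) (cong (λ t → + suc t) (ℕₚ.+-identityʳ d′))) ⟩
  mkℚᵘ (+ (a ℕ.* suc d′)) 0 ℚᵘ.* mkℚᵘ +[1+ b ] d′ ≃⟨ ℚᵘₚ.*-congʳ {mkℚᵘ +[1+ b ] d′} (toℚᵘ-ι (a ℕ.* suc d′)) ⟨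
  ℚ.toℚᵘ (ι (a ℕ.* suc d′)) ℚᵘ.* ℚ.toℚᵘ τ       ≃⟨ ℚₚ.toℚᵘ-homo-* (ι (a ℕ.* suc d′)) τ ⟨
  ℚ.toℚᵘ (ι (a ℕ.* suc d′) ℚ.* τ)               ∎)
  where
  open ℚᵘₚ.≤-Reasoning
  numerators : a ℕ.* suc d′ ℕ.≤ a ℕ.* suc d′ ℕ.* suc b ℕ.* suc d
  numerators = ℕₚ.≤-trans (ℕₚ.m≤m*n (a ℕ.* suc d′) (suc b)) (ℕₚ.m≤m*n _ (suc d))

-- The order of ℚ is decidable, so the search can run downwards from the Archimedean bound and stop
-- where the next smaller multiple fails.
ceiling : ∀ τ → 0ℚ ℚ.< τ → ∀ p → ∃[ m ] (p ℚ.≤ ι m ℚ.* τ × (0ℚ ℚ.≤ p → ι m ℚ.* τ ℚ.≤ p ℚ.+ τ))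
ceiling τ 0<τ p = let m , h = archimedean p τ 0<τ in go m h
  where
  go : ∀ m → p ℚ.≤ ι m ℚ.* τ → ∃[ m ] (p ℚ.≤ ι m ℚ.* τ × (0ℚ ℚ.≤ p → ι m ℚ.* τ ℚ.≤ p ℚ.+ τ))
  go zero    h = 0 , h , λ 0≤p → ℚₚ.≤-trans (ℚₚ.≤-reflexive (ℚₚ.*-zeroˡ τ)) (ℚₚ.+-mono-≤ 0≤p (ℚₚ.<⇒≤ 0<τ))
  go (suc m) h with p ℚ.≤? ι m ℚ.* τ
  ... | yes p≤ = go m p≤
  ... | no p≰  = suc m , h , λ _ → begin
    ι (suc m) ℚ.* τ       ≡⟨ cong (ℚ._* τ) (ι-+ 1 m) ⟩
    (1ℚ ℚ.+ ι m) ℚ.* τ    ≡⟨ solve 2 (λ m t → (con 1ℚ :+ m) :* t := m :* t :+ t) refl (ι m) τ ⟩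
    ι m ℚ.* τ ℚ.+ τ       ≤⟨ ℚₚ.+-monoˡ-≤ τ (ℚₚ.<⇒≤ (ℚₚ.≰⇒> p≰)) ⟩
    p ℚ.+ τ               ∎
    where
    open ℚₚ.≤-Reasoning
    open +-*-Solver

-- All decisions of the algorithm are computed from `q`, whose metric laws are exact. The gap
-- between `q≤d` and `d≤q` costs a factor 2 in the competitive ratio.
record Rounding {n} (M : Metric n) : Set where
  field
    unit    : ℚ
    0≤unit  : 0ℚ ℚ.≤ unit
    q       : Fin n → Fin n → ℕ
    q-refl  : ∀ x → q x x ≡ 0
    q-pos   : ∀ {x y} → x ≢ y → 1 ℕ.≤ q x y
    q-sym   : ∀ x y → q x y ≡ q y x
    q-tri   : ∀ x y z → q x z ℕ.≤ q x y ℕ.+ q y z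
    q≤d     : ∀ x y → fromℚ (unit ℚ.* ι (q x y)) ≤ d M x y
    d≤q     : ∀ x y → d M x y ≤ fromℚ (unit ℚ.* ι 2 ℚ.* ι (q x y))

module _ {n} (M : Metric n) where

  separation : ∃[ e ] (0ℚ ℚ.< e × Eventually (λ m → ∀ x y → x ≢ y → e ℚ.≤ seq (d M x y) m))
  separation = e , e>0 , eventually-∀ (λ x → eventually-∀ λ y → far x y (x ≟ y) (e≤ x y))
    where
    gap : ∀ {x y} → Dec (x ≡ y) → ℚ
    gap (yes _)  = 1ℚ
    gap (no x≢y) = proj₁ (d-pos M x≢y)
    gap>0 : ∀ {x y} (x≟y : Dec (x ≡ y)) → 0ℚ ℚ.< gap x≟y
    gap>0 (yes _)  = ℚₚ.positive⁻¹ 1ℚ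
    gap>0 (no x≢y) = proj₁ (proj₂ (d-pos M x≢y))
    row : ∀ x → ∃[ ε ] (0ℚ ℚ.< ε × ∀ y → ε ℚ.≤ gap (x ≟ y))
    row x = lower-bound (λ y → gap (x ≟ y)) (λ y → gap>0 (x ≟ y))
    all-rows : ∃[ ε ] (0ℚ ℚ.< ε × ∀ x → ε ℚ.≤ proj₁ (row x))
    all-rows = lower-bound (proj₁ ∘ row) (λ x → proj₁ (proj₂ (row x)))
    e = proj₁ all-rows
    e>0 = proj₁ (proj₂ all-rows)
    e≤ : ∀ x y → e ℚ.≤ gap (x ≟ y)
    e≤ x y = ℚₚ.≤-trans (proj₂ (proj₂ all-rows) x) (proj₂ (proj₂ (row x)) y)
    far : ∀ x y (x≟y : Dec (x ≡ y)) → e ℚ.≤ gap x≟y → Eventually (λ m → x ≢ y → e ℚ.≤ seq (d M x y) m)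
    far x y (yes x≡y) _   = 0 , λ _ _ x≢y → contradiction x≡y x≢y
    far x y (no x≢y)  e≤g =
      let ε , _ , N , h = d-pos M x≢y
      in N , λ m N≤m _ → ℚₚ.≤-trans e≤g (ℚₚ.≤-trans (ℚₚ.≤-reflexive (sym (ℚₚ.+-identityˡ ε))) (h m N≤m))

  private
    e   = proj₁ separation
    0<e = proj₁ (proj₂ separation)
    -- A quarter of the least gap, so that the errors of 7 τ collected in `off-diagonal≤d` stay
    -- below 2 e and are absorbed by the distance itself.
    τ   = ½ ℚ.* (½ ℚ.* e)
    0<τ = 0<½*p (0<½*p 0<e)
    0≤τ = ℚₚ.<⇒≤ 0<τ

    d[_] : ℕ → Fin n → Fin n → ℚ
    d[ m ] x y = seq (d M x y) m

    -- The integers are read off at a single index, which must suit all pairs and triples at once;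
    -- the last condition transfers the resulting bounds to all later terms.
    Settled : ℕ → Set
    Settled m = ((∀ x y → x ≢ y → e ℚ.≤ d[ m ] x y)
              × (∀ x y → d[ m ] x y ℚ.≤ d[ m ] y x ℚ.+ τ))
              × (∀ x y z → d[ m ] x z ℚ.≤ d[ m ] x y ℚ.+ d[ m ] y z ℚ.+ τ)
              × (∀ x y m′ → m ℕ.≤ m′ → ℚ.∣ d[ m′ ] x y ℚ.- d[ m ] x y ∣ ℚ.≤ τ)

    settled : Eventually Settled
    settled = eventually-×
      (eventually-× (proj₂ (proj₂ separation))
        (eventually-∀ λ x → eventually-∀ λ y → ≈⇒≤ {d M x y} {d M y x} (d-sym M x y) τ 0<τ))
      (eventually-× (eventually-∀ λ x → eventually-∀ λ y → eventually-∀ λ z → triangle M x y z τ 0<τ)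
        (eventually-∀ λ x → eventually-∀ λ y →
          let N , h = cauchy (d M x y) τ 0<τ
          in N , λ m N≤m m′ m≤m′ → h m′ m (ℕₚ.≤-trans N≤m m≤m′) N≤m))

    N = proj₁ settled

    far : ∀ m → N ℕ.≤ m → ∀ x y → x ≢ y → e ℚ.≤ d[ m ] x y
    far m N≤m = proj₁ (proj₁ (proj₂ settled m N≤m))

    near-sym : ∀ m → N ℕ.≤ m → ∀ x y → d[ m ] x y ℚ.≤ d[ m ] y x ℚ.+ τ
    near-sym m N≤m = proj₂ (proj₁ (proj₂ settled m N≤m))

    near-tri : ∀ x y z → d[ N ] x z ℚ.≤ d[ N ] x y ℚ.+ d[ N ] y z ℚ.+ τ
    near-tri = proj₁ (proj₂ (proj₂ settled N ℕₚ.≤-refl))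

    close : ∀ x y m → N ℕ.≤ m → ℚ.∣ d[ m ] x y ℚ.- d[ N ] x y ∣ ℚ.≤ τ
    close = proj₂ (proj₂ (proj₂ settled N ℕₚ.≤-refl))

    settled-≤ : ∀ x y m → N ℕ.≤ m → d[ m ] x y ℚ.≤ d[ N ] x y ℚ.+ τ
    settled-≤ x y m N≤m = ∣p-q∣≤e⇒p≤q+e (close x y m N≤m)

    settled-≥ : ∀ x y m → N ℕ.≤ m → d[ N ] x y ℚ.≤ d[ m ] x y ℚ.+ τ
    settled-≥ x y m N≤m = ∣p-q∣≤e⇒p≤q+e (subst (ℚ._≤ τ) (trans (sym (ℚₚ.∣-p∣≡∣p∣ (d[ m ] x y ℚ.- d[ N ] x y)))
      (cong ℚ.∣_∣ (solve 2 (λ p q → :- (p :- q) := q :- p) refl (d[ m ] x y) (d[ N ] x y)))) (close x y m N≤m))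
      where open +-*-Solver

    -- The approximations are symmetric only up to τ. Adding both directions restores exact
    -- symmetry, at the price that `b` approximates twice the distance.
    b : Fin n → Fin n → ℚ
    b x y = d[ N ] x y ℚ.+ d[ N ] y x

    b-sym : ∀ x y → b x y ≡ b y x
    b-sym x y = ℚₚ.+-comm (d[ N ] x y) (d[ N ] y x)

    b-tri : ∀ x y z → b x z ℚ.≤ b x y ℚ.+ b y z ℚ.+ τ ℚ.+ τ
    b-tri x y z = ℚₚ.≤-trans (ℚₚ.+-mono-≤ (near-tri x y z) (near-tri z y x)) (ℚₚ.≤-reflexive
      (solve 5 (λ a b c d t → a :+ b :+ t :+ (c :+ d :+ t) := (a :+ d) :+ (b :+ c) :+ t :+ t) refl
        (d[ N ] x y) (d[ N ] y z) (d[ N ] z y) (d[ N ] y x) τ))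
      where open +-*-Solver

    b≥0 : ∀ x y → x ≢ y → 0ℚ ℚ.≤ b x y
    b≥0 x y x≢y = ℚₚ.+-mono-≤ {0ℚ} {d[ N ] x y} {0ℚ} {d[ N ] y x}
      (ℚₚ.≤-trans (ℚₚ.<⇒≤ 0<e) (far N ℕₚ.≤-refl x y x≢y))
      (ℚₚ.≤-trans (ℚₚ.<⇒≤ 0<e) (far N ℕₚ.≤-refl y x (x≢y ∘ sym)))

    -- The 3 absorbs the errors of the approximate triangle inequality b-tri
    -- and of the rounding.
    off-diagonal : Fin n → Fin n → ℕ
    off-diagonal x y = 3 ℕ.+ proj₁ (ceiling τ 0<τ (b x y))

    off-diagonal-≥ : ∀ x y → b x y ℚ.+ ι 3 ℚ.* τ ℚ.≤ ι (off-diagonal x y) ℚ.* τ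
    off-diagonal-≥ x y = begin
      b x y ℚ.+ ι 3 ℚ.* τ              ≤⟨ ℚₚ.+-monoˡ-≤ (ι 3 ℚ.* τ) (proj₁ (proj₂ (ceiling τ 0<τ (b x y)))) ⟩
      ι c ℚ.* τ ℚ.+ ι 3 ℚ.* τ          ≡⟨ solve 3 (λ c s t → c :* t :+ s :* t := (s :+ c) :* t) refl (ι c) (ι 3) τ ⟩
      (ι 3 ℚ.+ ι c) ℚ.* τ              ≡⟨ cong (ℚ._* τ) (ι-+ 3 c) ⟨
      ι (3 ℕ.+ c) ℚ.* τ                ∎
      where
      open ℚₚ.≤-Reasoning
      open +-*-Solver
      c = proj₁ (ceiling τ 0<τ (b x y))

    off-diagonal-≤ : ∀ x y → x ≢ y → ι (off-diagonal x y) ℚ.* τ ℚ.≤ b x y ℚ.+ ι 4 ℚ.* τ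
    off-diagonal-≤ x y x≢y = begin
      ι (3 ℕ.+ c) ℚ.* τ                ≡⟨ cong (ℚ._* τ) (ι-+ 3 c) ⟩
      (ι 3 ℚ.+ ι c) ℚ.* τ              ≡⟨ solve 3 (λ s c t → (s :+ c) :* t := c :* t :+ s :* t) refl (ι 3) (ι c) τ ⟩
      ι c ℚ.* τ ℚ.+ ι 3 ℚ.* τ          ≤⟨ ℚₚ.+-monoˡ-≤ (ι 3 ℚ.* τ) (proj₂ (proj₂ (ceiling τ 0<τ (b x y))) (b≥0 x y x≢y)) ⟩
      b x y ℚ.+ τ ℚ.+ ι 3 ℚ.* τ        ≡⟨ solve 2 (λ b t → b :+ t :+ con (ι 3) :* t := b :+ con (ι 4) :* t) refl (b x y) τ ⟩
      b x y ℚ.+ ι 4 ℚ.* τ              ∎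
      where
      open ℚₚ.≤-Reasoning
      open +-*-Solver
      c = proj₁ (ceiling τ 0<τ (b x y))

    off-diagonal-tri : ∀ x y z → x ≢ z → off-diagonal x z ℕ.≤ off-diagonal x y ℕ.+ off-diagonal y z
    off-diagonal-tri x y z x≢z = ι-cancel-≤ (ℚₚ.*-cancelʳ-≤-pos τ {{ℚ.positive 0<τ}} (begin
      ι (off-diagonal x z) ℚ.* τ
        ≤⟨ off-diagonal-≤ x z x≢z ⟩
      b x z ℚ.+ ι 4 ℚ.* τ
        ≤⟨ ℚₚ.+-monoˡ-≤ (ι 4 ℚ.* τ) (b-tri x y z) ⟩
      b x y ℚ.+ b y z ℚ.+ τ ℚ.+ τ ℚ.+ ι 4 ℚ.* τ
        ≡⟨ solve 3 (λ a b t → a :+ b :+ t :+ t :+ con (ι 4) :* t := (a :+ con (ι 3) :* t) :+ (b :+ con (ι 3) :* t))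
             refl (b x y) (b y z) τ ⟩
      (b x y ℚ.+ ι 3 ℚ.* τ) ℚ.+ (b y z ℚ.+ ι 3 ℚ.* τ)
        ≤⟨ ℚₚ.+-mono-≤ (off-diagonal-≥ x y) (off-diagonal-≥ y z) ⟩
      ι (off-diagonal x y) ℚ.* τ ℚ.+ ι (off-diagonal y z) ℚ.* τ
        ≡⟨ ℚₚ.*-distribʳ-+ τ (ι (off-diagonal x y)) (ι (off-diagonal y z)) ⟨
      (ι (off-diagonal x y) ℚ.+ ι (off-diagonal y z)) ℚ.* τ
        ≡⟨ cong (ℚ._* τ) (ι-+ (off-diagonal x y) (off-diagonal y z)) ⟨
      ι (off-diagonal x y ℕ.+ off-diagonal y z) ℚ.* τ ∎))
      where
      open ℚₚ.≤-Reasoning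
      open +-*-Solver

    -- For distinct points, q τ lies between 2 d and 4 d; a quarter of τ therefore makes `q≤d` hold
    -- and leaves the factor 2 in `d≤q`.
    unit : ℚ
    unit = ½ ℚ.* (½ ℚ.* τ)

    ½*-mono : ∀ {p r} → p ℚ.≤ r → ½ ℚ.* p ℚ.≤ ½ ℚ.* r
    ½*-mono = ℚₚ.*-monoˡ-≤-nonNeg ½

    -- 8 τ = 2 e ≤ 2 d(x, y)
    off-diagonal≤d : ∀ x y → x ≢ y → ∀ m → N ℕ.≤ m → unit ℚ.* ι (off-diagonal x y) ℚ.≤ d[ m ] x y
    off-diagonal≤d x y x≢y m N≤m = begin
      unit ℚ.* ι (off-diagonal x y)
        ≡⟨ solve 2 (λ t o → con ½ :* (con ½ :* t) :* o := con ½ :* (con ½ :* (o :* t))) refl τ (ι (off-diagonal x y)) ⟩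
      ½ ℚ.* (½ ℚ.* (ι (off-diagonal x y) ℚ.* τ))
        ≤⟨ ½*-mono (½*-mono (begin
          ι (off-diagonal x y) ℚ.* τ               ≤⟨ off-diagonal-≤ x y x≢y ⟩
          b x y ℚ.+ ι 4 ℚ.* τ                      ≤⟨ ℚₚ.+-monoˡ-≤ (ι 4 ℚ.* τ) (ℚₚ.+-mono-≤ (settled-≥ x y m N≤m)
                                                        (ℚₚ.≤-trans (settled-≥ y x m N≤m) (ℚₚ.+-monoˡ-≤ τ (near-sym m N≤m y x)))) ⟩
          D ℚ.+ τ ℚ.+ (D ℚ.+ τ ℚ.+ τ) ℚ.+ ι 4 ℚ.* τ
            ≡⟨ solve 2 (λ D t → D :+ t :+ (D :+ t :+ t) :+ con (ι 4) :* t := D :+ D :+ con (ι 7) :* t) refl D τ ⟩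
          D ℚ.+ D ℚ.+ ι 7 ℚ.* τ
            ≤⟨ ℚₚ.+-monoʳ-≤ (D ℚ.+ D) (ℚₚ.*-monoʳ-≤-nonNeg τ {{ℚ.nonNegative 0≤τ}} (ι-mono {7} {8} (ℕₚ.n≤1+n 7))) ⟩
          D ℚ.+ D ℚ.+ ι 8 ℚ.* τ
            ≡⟨ cong (D ℚ.+ D ℚ.+_) (solve 1 (λ e → con (ι 8) :* (con ½ :* (con ½ :* e)) := e :+ e) refl e) ⟩
          D ℚ.+ D ℚ.+ (e ℚ.+ e)
            ≤⟨ ℚₚ.+-monoʳ-≤ (D ℚ.+ D) (ℚₚ.+-mono-≤ (far m N≤m x y x≢y) (far m N≤m x y x≢y)) ⟩
          D ℚ.+ D ℚ.+ (D ℚ.+ D)                    ∎)) ⟩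
      ½ ℚ.* (½ ℚ.* (D ℚ.+ D ℚ.+ (D ℚ.+ D)))
        ≡⟨ solve 1 (λ D → con ½ :* (con ½ :* (D :+ D :+ (D :+ D))) := D) refl D ⟩
      D ∎
      where
      open ℚₚ.≤-Reasoning
      open +-*-Solver
      D = d[ m ] x y

    d≤off-diagonal : ∀ x y m → N ℕ.≤ m → d[ m ] x y ℚ.≤ unit ℚ.* ι 2 ℚ.* ι (off-diagonal x y)
    d≤off-diagonal x y m N≤m = begin
      D                                               ≡⟨ solve 1 (λ D → D := con ½ :* (D :+ D)) refl D ⟩
      ½ ℚ.* (D ℚ.+ D)                                 ≤⟨ ½*-mono (begin
        D ℚ.+ D                                         ≤⟨ ℚₚ.+-mono-≤ (settled-≤ x y m N≤m)
                                                             (ℚₚ.≤-trans (near-sym m N≤m x y) (ℚₚ.+-monoˡ-≤ τ (settled-≤ y x m N≤m))) ⟩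
        d[ N ] x y ℚ.+ τ ℚ.+ (d[ N ] y x ℚ.+ τ ℚ.+ τ)   ≡⟨ solve 3 (λ a b t → a :+ t :+ (b :+ t :+ t) := (a :+ b) :+ con (ι 3) :* t)
                                                             refl (d[ N ] x y) (d[ N ] y x) τ ⟩
        b x y ℚ.+ ι 3 ℚ.* τ                             ≤⟨ off-diagonal-≥ x y ⟩
        ι (off-diagonal x y) ℚ.* τ                      ∎) ⟩
      ½ ℚ.* (ι (off-diagonal x y) ℚ.* τ)              ≡⟨ solve 2 (λ o t → con ½ :* (o :* t) := con ½ :* (con ½ :* t) :* con (ι 2) :* o)
                                                           refl (ι (off-diagonal x y)) τ ⟩
      unit ℚ.* ι 2 ℚ.* ι (off-diagonal x y)           ∎
      where
      open ℚₚ.≤-Reasoning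
      open +-*-Solver
      D = d[ m ] x y

    entry : ∀ {x y : Fin n} → Dec (x ≡ y) → ℕ
    entry {x} {y} x≟y = if does x≟y then 0 else off-diagonal x y

    entry-yes : ∀ {x} (x≟x : Dec (x ≡ x)) → entry x≟x ≡ 0
    entry-yes (yes _)  = refl
    entry-yes (no x≢x) = contradiction refl x≢x

  rounding : Rounding M
  rounding = record
    { unit   = unit
    ; 0≤unit = ℚₚ.<⇒≤ (0<½*p (0<½*p 0<τ))
    ; q      = λ x y → entry (x ≟ y)
    ; q-refl = λ x → entry-yes (x ≟ x)
    ; q-pos  = λ {x} {y} x≢y → pos x≢y (x ≟ y)
    ; q-sym  = λ x y → symm (x ≟ y) (y ≟ x)
    ; q-tri  = λ x y z → tri (x ≟ y) (y ≟ z) (x ≟ z)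
    ; q≤d    = λ x y → lower (x ≟ y)
    ; d≤q    = λ x y → upper (x ≟ y)
    }
    where
    pos : ∀ {x y} → x ≢ y → (d : Dec (x ≡ y)) → 1 ℕ.≤ entry d
    pos x≢y (yes x≡y) = contradiction x≡y x≢y
    pos x≢y (no _)    = ℕ.s≤s ℕ.z≤n
    symm : ∀ {x y} (d : Dec (x ≡ y)) (e : Dec (y ≡ x)) → entry d ≡ entry e
    symm (yes _)   (yes _)   = refl
    symm (yes x≡y) (no y≢x)  = contradiction (sym x≡y) y≢x
    symm (no x≢y)  (yes y≡x) = contradiction (sym y≡x) x≢y
    symm {x} {y} (no _) (no _) = cong (λ p → 3 ℕ.+ proj₁ (ceiling τ 0<τ p)) (b-sym x y)
    tri : ∀ {x y z} (d : Dec (x ≡ y)) (e : Dec (y ≡ z)) (f : Dec (x ≡ z)) → entry f ℕ.≤ entry d ℕ.+ entry e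
    tri d          e          (yes _)  = ℕ.z≤n
    tri (yes refl) (yes refl) (no x≢z) = contradiction refl x≢z
    tri (yes refl) (no _)     (no _)   = ℕₚ.≤-refl
    tri (no _)     (yes refl) (no _)   = ℕₚ.m≤m+n _ 0
    tri {x} {y} {z} (no _) (no _) (no x≢z) = off-diagonal-tri x y z x≢z
    lower : ∀ {x y} (x≟y : Dec (x ≡ y)) → fromℚ (unit ℚ.* ι (entry x≟y)) ≤ d M x y
    lower {x} (yes refl) = subst (λ p → fromℚ p ≤ d M x x) (sym (ℚₚ.*-zeroʳ unit))
      (≈⇒≤ {0ℝ} {d M x x} (≈-sym {d M x x} {0ℝ} (d-refl M refl)))
    lower {x} {y} (no x≢y) = ≤-eventually {fromℚ (unit ℚ.* ι (off-diagonal x y))} {d M x y} (N , off-diagonal≤d x y x≢y)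
    upper : ∀ {x y} (x≟y : Dec (x ≡ y)) → d M x y ≤ fromℚ (unit ℚ.* ι 2 ℚ.* ι (entry x≟y))
    upper {x} (yes refl) = subst (λ p → d M x x ≤ fromℚ p) (sym (ℚₚ.*-zeroʳ (unit ℚ.* ι 2)))
      (≈⇒≤ {d M x x} {0ℝ} (d-refl M refl))
    upper {x} {y} (no x≢y) = ≤-eventually {d M x y} {fromℚ (unit ℚ.* ι 2 ℚ.* ι (off-diagonal x y))} (N , d≤off-diagonal x y)

-- The algorithm

γι-+ : ∀ γ a b → γ ℚ.* ι a ℚ.+ γ ℚ.* ι b ≡ γ ℚ.* ι (a ℕ.+ b)
γι-+ γ a b = trans (sym (ℚₚ.*-distribˡ-+ γ (ι a) (ι b))) (cong (γ ℚ.*_) (sym (ι-+ a b)))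

module _ {γ : ℚ} {x y : ℝ} (a b : ℕ) where

  +-≤-γι : x ≤ fromℚ (γ ℚ.* ι a) → y ≤ fromℚ (γ ℚ.* ι b) → x + y ≤ fromℚ (γ ℚ.* ι (a ℕ.+ b))
  +-≤-γι x≤ y≤ = subst (λ t → x + y ≤ fromℚ t) (γι-+ γ a b)
    (+-mono-≤ {x} {fromℚ (γ ℚ.* ι a)} {y} {fromℚ (γ ℚ.* ι b)} x≤ y≤)

  γι-≤-+ : fromℚ (γ ℚ.* ι a) ≤ x → fromℚ (γ ℚ.* ι b) ≤ y → fromℚ (γ ℚ.* ι (a ℕ.+ b)) ≤ x + y
  γι-≤-+ ≤x ≤y = subst (λ t → fromℚ t ≤ x + y) (γι-+ γ a b)
    (+-mono-≤ {fromℚ (γ ℚ.* ι a)} {x} {fromℚ (γ ℚ.* ι b)} {y} ≤x ≤y)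

module _ {n : ℕ} (M : Metric n) (γ : ℚ) (D : Fin n → Fin n → ℕ) where

  ∑-zipWith-≤ : (∀ x y → d M x y ≤ fromℚ (γ ℚ.* ι (D x y))) → ∀ {k} (C C′ : Config k n) →
    ∑ (toList (zipWith (d M) C C′)) ≤ fromℚ (γ ℚ.* ι (movement D C C′))
  ∑-zipWith-≤ d≤ []      []        = ≤-pointwise {0ℝ} {fromℚ (γ ℚ.* 0ℚ)} λ _ → ℚₚ.≤-reflexive (sym (ℚₚ.*-zeroʳ γ))
  ∑-zipWith-≤ d≤ (x ∷ C) (y ∷ C′) =
    subst (λ t → ∑ (toList (zipWith (d M) (x ∷ C) (y ∷ C′))) ≤ fromℚ (γ ℚ.* ι t))
      (sym (sumOver-suc λ l → D (lookup (x ∷ C) l) (lookup (y ∷ C′) l)))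
      (+-≤-γι {γ = γ} {d M x y} {∑ (toList (zipWith (d M) C C′))} (D x y) (movement D C C′) (d≤ x y) (∑-zipWith-≤ d≤ C C′))

  ∑-zipWith-≥ : (∀ x y → fromℚ (γ ℚ.* ι (D x y)) ≤ d M x y) → ∀ {k} (C C′ : Config k n) →
    fromℚ (γ ℚ.* ι (movement D C C′)) ≤ ∑ (toList (zipWith (d M) C C′))
  ∑-zipWith-≥ ≤d []      []        = ≤-pointwise {fromℚ (γ ℚ.* 0ℚ)} {0ℝ} λ _ → ℚₚ.≤-reflexive (ℚₚ.*-zeroʳ γ)
  ∑-zipWith-≥ ≤d (x ∷ C) (y ∷ C′) =
    subst (λ t → fromℚ (γ ℚ.* ι t) ≤ ∑ (toList (zipWith (d M) (x ∷ C) (y ∷ C′))))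
      (sym (sumOver-suc λ l → D (lookup (x ∷ C) l) (lookup (y ∷ C′) l)))
      (γι-≤-+ {γ = γ} {d M x y} {∑ (toList (zipWith (d M) C C′))} (D x y) (movement D C C′) (≤d x y) (∑-zipWith-≥ ≤d C C′))

scheduleLength : ∀ {k n} → (Fin n → Fin n → ℕ) → Config k n → (σ : List (Request n)) → Vec (Move k n) (length σ) → ℕ
scheduleLength D C []      []       = 0
scheduleLength D C (r ∷ σ) (a ∷ as) =
  movement D C (atPickup r a) ℕ.+ scheduleLength D (afterService r a) σ as

scheduleCost-≥ : ∀ {k n} (M : Metric n) γ D → (∀ x y → fromℚ (γ ℚ.* ι (D x y)) ≤ d M x y) →
  ∀ (C : Config k n) σ as → fromℚ (γ ℚ.* ι (scheduleLength D C σ as)) ≤ scheduleCost M C σ as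
scheduleCost-≥ M γ D ≤d C []      []       = ≤-pointwise {fromℚ (γ ℚ.* 0ℚ)} {0ℝ} λ _ → ℚₚ.≤-reflexive (ℚₚ.*-zeroʳ γ)
scheduleCost-≥ M γ D ≤d C (r ∷ σ) (a ∷ as) =
  γι-≤-+ {γ = γ} {moveCost M C r a} {scheduleCost M (afterService r a) σ as}
    (movement D C (atPickup r a)) (scheduleLength D (afterService r a) σ as)
    (∑-zipWith-≥ M γ D ≤d C (atPickup r a)) (scheduleCost-≥ M γ D ≤d (afterService r a) σ as)

-- Obliviousness enters here: one schedule is measured in all the metrics, so the sums can be
-- exchanged and the stretch applied to each single move.
sumOver-scheduleLength : ∀ {k n} {I : Set} (is : List I) (D : I → Fin n → Fin n → ℕ) (q : Fin n → Fin n → ℕ) N c →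
  (∀ x y → sumOver is (λ i → D i x y) ℕ.≤ N ℕ.* (c ℕ.* q x y)) → ∀ (C : Config k n) σ as →
  sumOver is (λ i → scheduleLength (D i) C σ as) ℕ.≤ N ℕ.* (c ℕ.* scheduleLength q C σ as)
sumOver-scheduleLength is D q N c D≤ C [] [] = ℕₚ.≤-trans
  (ℕₚ.≤-reflexive (sumOver-≡0 is λ _ → refl)) ℕ.z≤n
sumOver-scheduleLength {k} is D q N c D≤ C (r ∷ σ) (a ∷ as) = begin
  sumOver is (λ i → movement (D i) C C′ ℕ.+ scheduleLength (D i) (afterService r a) σ as)
    ≡⟨ sumOver-+ is (λ i → movement (D i) C C′) (λ i → scheduleLength (D i) (afterService r a) σ as) ⟩
  sumOver is (λ i → movement (D i) C C′) ℕ.+ sumOver is (λ i → scheduleLength (D i) (afterService r a) σ as)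
    ≤⟨ ℕₚ.+-mono-≤ moves (sumOver-scheduleLength is D q N c D≤ (afterService r a) σ as) ⟩
  N ℕ.* (c ℕ.* movement q C C′) ℕ.+ N ℕ.* (c ℕ.* rest)
    ≡⟨ solve 4 (λ N c m r → N :* (c :* m) :+ N :* (c :* r) := N :* (c :* (m :+ r))) refl N c (movement q C C′) rest ⟩
  N ℕ.* (c ℕ.* (movement q C C′ ℕ.+ rest)) ∎
  where
  open ℕₚ.≤-Reasoning
  open ℕ-Solver.+-*-Solver
  C′ = atPickup r a
  rest = scheduleLength q (afterService r a) σ as
  moves : sumOver is (λ i → movement (D i) C C′) ℕ.≤ N ℕ.* (c ℕ.* movement q C C′)
  moves = begin
    sumOver is (λ i → movement (D i) C C′)
      ≡⟨ sumOver-swap is (allFin k) (λ i l → D i (lookup C l) (lookup C′ l)) ⟩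
    sumOver (allFin k) (λ l → sumOver is (λ i → D i (lookup C l) (lookup C′ l)))
      ≤⟨ sumOver-mono (allFin k) (λ l → D≤ (lookup C l) (lookup C′ l)) ⟩
    sumOver (allFin k) (λ l → N ℕ.* (c ℕ.* q (lookup C l) (lookup C′ l)))
      ≡⟨ trans (sumOver-*ˡ (allFin k) N _) (cong (N ℕ.*_) (sumOver-*ˡ (allFin k) c _)) ⟩
    N ℕ.* (c ℕ.* movement q C C′) ∎

module _ {k n : ℕ} .{{_ : NonZero k}} (M : Metric n) (R : Rounding M) where

  open Rounding R
  open Dominating

  private
    Ω = embeddings q q-refl q-pos q-sym q-tri
    γ = unit ℚ.* ι 2

    0≤γ : 0ℚ ℚ.≤ γ
    0≤γ = subst (ℚ._≤ γ) (ℚₚ.*-zeroˡ (ι 2)) (ℚₚ.*-monoʳ-≤-nonNeg (ι 2) 0≤unit)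

    weights : Dominating q → Config k n → Request n → Fin k → ℕ
    weights ω X r = proj₁ (balancedWeights (λ j → δ (metric ω) (lookup X j) (source r)))

    weights>0 : ∀ ω X r → 0 ℕ.< sumOver (allFin k) (weights ω X r)
    weights>0 ω X r = proj₁ (proj₂ (balancedWeights (λ j → δ (metric ω) (lookup X j) (source r))))

  -- The memory is the ultrametric drawn at the start and is never changed. The algorithm is lazy:
  -- the target is the current configuration, so only the serving taxi moves.
  algorithm : OnlineAlgorithm k n
  algorithm = record
    { Memory = Dominating q
    ; init   = λ _ → pick id Ω (λ _ → 1) (embeddings-nonempty q q-refl q-pos q-sym q-tri)
    ; step   = λ ω X r → pick (λ j → move j X , ω) (allFin k) (weights ω X r) (weights>0 ω X r)
    }

  d≤δ : ∀ (ω : Dominating q) x y → d M x y ≤ fromℚ (γ ℚ.* ι (δ (metric ω) x y))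
  d≤δ ω x y = ≤-trans {d M x y} {fromℚ (γ ℚ.* ι (q x y))} {fromℚ (γ ℚ.* ι (δ (metric ω) x y))} (d≤q x y)
    (≤-pointwise {fromℚ (γ ℚ.* ι (q x y))} {fromℚ (γ ℚ.* ι (δ (metric ω) x y))} λ _ →
      ℚₚ.*-monoˡ-≤-nonNeg γ {{ℚ.nonNegative 0≤γ}} (ι-mono (dominates ω x y)))

  moveCost-≤ : ∀ (ω : Dominating q) (X : Config k n) r j →
    moveCost M X r (move j X) ≤ fromℚ (γ ℚ.* ι (δ (metric ω) (lookup X j) (source r)))
  moveCost-≤ ω X r j = subst (λ t → moveCost M X r (move j X) ≤ fromℚ (γ ℚ.* ι t))
    (movement-single (metric ω) X j (source r))
    (∑-zipWith-≤ M γ (δ (metric ω)) (d≤δ ω) X (X [ j ]≔ source r))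

  -- The potential argument against an arbitrary schedule `as`. The matching exists only in the
  -- analysis, and each choice of serving taxi continues with a permutation of its own, so the
  -- induction has to range over all π.
  expectedCostFrom-≤ : ∀ ω X Y π σ as → expectedCostFrom M algorithm ω X σ ≤
    fromℚ (γ ℚ.* ι (2 ^ k ℕ.* (matching (metric ω) X Y π ℕ.+ scheduleLength (δ (metric ω)) Y σ as)))
  expectedCostFrom-≤ ω X Y π [] [] = ≤-pointwise {0ℝ}
    {fromℚ (γ ℚ.* ι (2 ^ k ℕ.* (matching (metric ω) X Y π ℕ.+ 0)))} λ _ →
    subst (ℚ._≤ γ ℚ.* ι (2 ^ k ℕ.* (matching (metric ω) X Y π ℕ.+ 0))) (ℚₚ.*-zeroʳ γ)
      (ℚₚ.*-monoˡ-≤-nonNeg γ {{ℚ.nonNegative 0≤γ}} (0≤ι (2 ^ k ℕ.* (matching (metric ω) X Y π ℕ.+ 0))))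
  expectedCostFrom-≤ ω X Y π (r@(s ⇒ t) ∷ σ) (move i′ T ∷ as) =
    𝔼-pick-≤ (λ j → move j X , ω) (allFin k) (weights ω X r) (weights>0 ω X r) 0≤γ
      (λ (a , ω′) → moveCost M X r a + expectedCostFrom M algorithm ω′ (afterService r a) σ)
      (λ j → x j ℕ.+ 2 ^ k ℕ.* (m′ j ℕ.+ rest))
      (λ j → +-≤-γι {γ = γ} {moveCost M X r (move j X)} {expectedCostFrom M algorithm ω (X [ j ]≔ t) σ}
        (x j) (2 ^ k ℕ.* (m′ j ℕ.+ rest))
        (moveCost-≤ ω X r j) (expectedCostFrom-≤ ω (X [ j ]≔ t) (T [ i′ ]≔ t) (π′ j) σ as))
      (potential-drop (metric ω) X Y T i′ s t π rest (weights ω X r)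
        (proj₂ (proj₂ (balancedWeights (λ j → δ (metric ω) (lookup X j) s)))))
    where
    rest = scheduleLength (δ (metric ω)) (T [ i′ ]≔ t) σ as
    x : Fin k → ℕ
    x j = δ (metric ω) (lookup X j) s
    π′ : Fin k → Permutation′ k
    π′ j = proj₁ (rematch (metric ω) X T i′ s t π j)
    m′ : Fin k → ℕ
    m′ j = matching (metric ω) (X [ j ]≔ t) (T [ i′ ]≔ t) (π′ j)

  stretch : ℕ
  stretch = 12 ℕ.+ 8 ℕ.* ⌊log₂ n ⌋

  expectedCost-≤ : ∀ C σ as → expectedCost M algorithm C σ ≤
    fromℚ (γ ℚ.* ι (2 ^ k ℕ.* (stretch ℕ.* scheduleLength q C σ as)))
  expectedCost-≤ C σ as = 𝔼-pick-≤ id Ω (λ _ → 1) (embeddings-nonempty q q-refl q-pos q-sym q-tri) 0≤γ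
    (λ ω → expectedCostFrom M algorithm ω C σ) (λ ω → 2 ^ k ℕ.* ℓ ω)
    -- Both sides start in `C`, where the identity matching costs 0; this is why the additive
    -- constant is 0.
    (λ ω → subst (λ t → expectedCostFrom M algorithm ω C σ ≤ fromℚ (γ ℚ.* ι (2 ^ k ℕ.* (t ℕ.+ ℓ ω))))
      (matching-refl (metric ω) C) (expectedCostFrom-≤ ω C C idₚ σ as))
    (begin
      sumOver Ω (λ ω → 1 ℕ.* (2 ^ k ℕ.* ℓ ω))
        ≡⟨ trans (sumOver-cong Ω λ ω → ℕₚ.*-identityˡ (2 ^ k ℕ.* ℓ ω)) (sumOver-*ˡ Ω (2 ^ k) ℓ) ⟩
      2 ^ k ℕ.* sumOver Ω ℓ
        ≤⟨ ℕₚ.*-monoʳ-≤ (2 ^ k) (sumOver-scheduleLength Ω (λ ω → δ (metric ω)) q N stretch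
             (embeddings-stretch q q-refl q-pos q-sym q-tri) C σ as) ⟩
      2 ^ k ℕ.* (N ℕ.* (stretch ℕ.* Q))
        ≡⟨ solve 3 (λ K N Q → K :* (N :* Q) := N :* (K :* Q)) refl (2 ^ k) N (stretch ℕ.* Q) ⟩
      N ℕ.* (2 ^ k ℕ.* (stretch ℕ.* Q)) ∎)
    where
    open ℕₚ.≤-Reasoning
    open ℕ-Solver.+-*-Solver
    ℓ : Dominating q → ℕ
    ℓ ω = scheduleLength (δ (metric ω)) C σ as
    N = sumOver Ω (λ _ → 1)
    Q = scheduleLength q C σ as

-- The competitive ratio

corollary2 : ∃[ C ] (0ℝ < C × (∀ (k n : ℕ) .{{_ : NonZero k}} .{{_ : NonTrivial n}} (M : Metric n) →
    ∃[ A ] Competitive {k} {n} M A (C * fromℕ (2 ^ k) * log₂ n)))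
-- 40 = 2 * (12 + 8): a factor 2 is lost in rounding, and the stretch 12 + 8 l is at most 20 l,
-- since n ≥ 2 gives l ≥ 1.
corollary2 = fromℕ 40 , (1ℚ , ℚₚ.positive⁻¹ 1ℚ , 0 , λ _ _ → ι-mono {1} {40} (ℕ.s≤s ℕ.z≤n)) ,
  λ k n M → algorithm {k} M (rounding M) , λ C₀ → 0ℝ , λ σ → competitive k n M C₀ σ
  where
  module _ (k n : ℕ) .{{_ : NonZero k}} .{{_ : NonTrivial n}} (M : Metric n) (C₀ : Config k n) (σ : List (Request n)) where
    open Rounding (rounding M)

    A = algorithm {k} M (rounding M)
    l = ⌊log₂ n ⌋
    ρ = fromℕ 40 * fromℕ (2 ^ k) * log₂ n
    n≢0 : NonZero n
    n≢0 = ℕ.>-nonZero (ℕₚ.<-trans (ℕ.s≤s ℕ.z≤n) (ℕ.nonTrivial⇒n>1 n))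
    1≤l : 1 ℕ.≤ l
    1≤l = ⌊log₂⌋-mono-≤ {2} {n} (ℕ.nonTrivial⇒n>1 n)

    ρ≥ : ∀ m → ι (40 ℕ.* 2 ^ k ℕ.* l) ℚ.≤ seq ρ m
    ρ≥ m = begin
      ι (40 ℕ.* 2 ^ k ℕ.* l)             ≡⟨ trans (ι-* (40 ℕ.* 2 ^ k) l) (cong (ℚ._* ι l) (ι-* 40 (2 ^ k))) ⟩
      ι 40 ℚ.* ι (2 ^ k) ℚ.* ι l         ≤⟨ ℚₚ.*-monoˡ-≤-nonNeg (ι 40 ℚ.* ι (2 ^ k))
                                              {{ℚ.nonNegative (subst (0ℚ ℚ.≤_) (ι-* 40 (2 ^ k)) (0≤ι (40 ℕ.* 2 ^ k)))}}
                                              (⌊log₂⌋≤log₂ n {{n≢0}} m) ⟩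
      seq ρ m                            ∎
      where open ℚₚ.≤-Reasoning

    -- An optimal schedule cannot be selected constructively, so the bound is proved against every
    -- schedule and then passes to the minimum.
    ≤-schedule : ∀ as → expectedCost M A C₀ σ ≤ ρ * scheduleCost M C₀ σ as
    ≤-schedule as = ≤-trans {expectedCost M A C₀ σ} {fromℚ upper} {ρ * scheduleCost M C₀ σ as}
      (expectedCost-≤ M (rounding M) C₀ σ as)
      (≤-trans {fromℚ upper} {fromℚ (ι (40 ℕ.* 2 ^ k ℕ.* l) ℚ.* (unit ℚ.* ι Q))} {ρ * scheduleCost M C₀ σ as}
        (≤-pointwise {fromℚ upper} {fromℚ (ι (40 ℕ.* 2 ^ k ℕ.* l) ℚ.* (unit ℚ.* ι Q))} λ _ → upper≤)
        (fromℚ-*-≤ {ι (40 ℕ.* 2 ^ k ℕ.* l)} {unit ℚ.* ι Q} {ρ} {scheduleCost M C₀ σ as}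
          (0≤ι (40 ℕ.* 2 ^ k ℕ.* l)) (subst (ℚ._≤ unit ℚ.* ι Q) (ℚₚ.*-zeroʳ unit)
            (ℚₚ.*-monoˡ-≤-nonNeg unit {{ℚ.nonNegative 0≤unit}} (0≤ι Q)))
          ρ≥ (scheduleCost-≥ M unit q q≤d C₀ σ as)))
      where
      Q = scheduleLength q C₀ σ as
      upper = unit ℚ.* ι 2 ℚ.* ι (2 ^ k ℕ.* ((12 ℕ.+ 8 ℕ.* l) ℕ.* Q))
      integers : 2 ℕ.* (2 ^ k ℕ.* ((12 ℕ.+ 8 ℕ.* l) ℕ.* Q)) ℕ.≤ 40 ℕ.* 2 ^ k ℕ.* l ℕ.* Q
      integers = begin
        2 ℕ.* (2 ^ k ℕ.* ((12 ℕ.+ 8 ℕ.* l) ℕ.* Q))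
          ≤⟨ ℕₚ.*-monoʳ-≤ 2 (ℕₚ.*-monoʳ-≤ (2 ^ k) (ℕₚ.*-monoˡ-≤ Q (ℕₚ.+-monoˡ-≤ (8 ℕ.* l) (ℕₚ.*-monoʳ-≤ 12 1≤l)))) ⟩
        2 ℕ.* (2 ^ k ℕ.* ((12 ℕ.* l ℕ.+ 8 ℕ.* l) ℕ.* Q))
          ≡⟨ solve 3 (λ K l Q → con 2 :* (K :* ((con 12 :* l :+ con 8 :* l) :* Q)) := con 40 :* K :* l :* Q) refl (2 ^ k) l Q ⟩
        40 ℕ.* 2 ^ k ℕ.* l ℕ.* Q ∎
        where
        open ℕₚ.≤-Reasoning
        open ℕ-Solver.+-*-Solver
      upper≤ : upper ℚ.≤ ι (40 ℕ.* 2 ^ k ℕ.* l) ℚ.* (unit ℚ.* ι Q)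
      upper≤ = begin
        unit ℚ.* ι 2 ℚ.* ι (2 ^ k ℕ.* ((12 ℕ.+ 8 ℕ.* l) ℕ.* Q))
          ≡⟨ trans (ℚₚ.*-assoc unit (ι 2) (ι Z)) (cong (unit ℚ.*_) (sym (ι-* 2 Z))) ⟩
        unit ℚ.* ι (2 ℕ.* (2 ^ k ℕ.* ((12 ℕ.+ 8 ℕ.* l) ℕ.* Q)))
          ≤⟨ ℚₚ.*-monoˡ-≤-nonNeg unit {{ℚ.nonNegative 0≤unit}} (ι-mono integers) ⟩
        unit ℚ.* ι (40 ℕ.* 2 ^ k ℕ.* l ℕ.* Q)
          ≡⟨ cong (unit ℚ.*_) (ι-* (40 ℕ.* 2 ^ k ℕ.* l) Q) ⟩
        unit ℚ.* (ι (40 ℕ.* 2 ^ k ℕ.* l) ℚ.* ι Q)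
          ≡⟨ solve 3 (λ u r q → u :* (r :* q) := r :* (u :* q)) refl unit (ι (40 ℕ.* 2 ^ k ℕ.* l)) (ι Q) ⟩
        ι (40 ℕ.* 2 ^ k ℕ.* l) ℚ.* (unit ℚ.* ι Q) ∎
        where
        open ℚₚ.≤-Reasoning
        open +-*-Solver
        Z = 2 ^ k ℕ.* ((12 ℕ.+ 8 ℕ.* l) ℕ.* Q)

    competitive : expectedCost M A C₀ σ ≤ ρ * OPT M C₀ σ + 0ℝ
    competitive = ≤-trans {expectedCost M A C₀ σ} {ρ * OPT M C₀ σ} {ρ * OPT M C₀ σ + 0ℝ}
      (≤-*-foldr-⊓ {x = expectedCost M A C₀ σ} {ρ} (scheduleCost M C₀ σ)
        (scheduleCost M C₀ σ first) (allVecs (allMoves k n) (length σ)) (≤-schedule first) ≤-schedule)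
      (≤-pointwise {ρ * OPT M C₀ σ} {ρ * OPT M C₀ σ + 0ℝ} λ m → ℚₚ.≤-reflexive (sym (ℚₚ.+-identityʳ (seq (ρ * OPT M C₀ σ) m))))
      where
      first = replicate (length σ) (move (fromℕ< (ℕ.>-nonZero⁻¹ k)) C₀)
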